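{- Let $f(x),g(x)\in\mathbb{Z}[x]$ be polynomials of positive degree having no common complex root, let $m=\deg(f)$, $n=\deg(g)$, and $d=\gcd(L(f),L(g))$. Then $$R(f,g)\mid d^{m+n-1}\,B(f,g)^{\max(m,n)}.$$ Moreover, if both $f$ and $g$ are monic, then $R(f,g)\mid B(f,g)^{\min(m,n)}$.
   Context: $L(h)$ denotes the leading coefficient of $h\in\mathbb{Z}[x]$. There are unique $p,q\in\mathbb{Q}[x]$ with $pf+qg=1$, $\deg p<\deg g$, $\deg q<\deg f$; $B(f,g)$ is the least common multiple of the denominators (in lowest terms) of all coefficients of these $p$ and $q$. $R(f,g)=|\mathrm{Res}(f,g)|$, the absolute value of the resultant of $f$ and $g$. -}

module Defs where

open import Data.Nat as ℕ using (ℕ; zero; suc; _<?_; _≤?_)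
open import Data.Nat.LCM using (lcm)
open import Data.Nat.GCD using (gcd)
open import Data.Fin using (Fin; zero; suc; toℕ; fromℕ<; punchIn)
open import Data.Integer as ℤ using (ℤ; ∣_∣)
open import Data.Rational as ℚ using (ℚ; 0ℚ; 1ℚ; ↧ₙ_)
open import Relation.Nullary using (yes; no)

-- A polynomial of (formal) degree m over a ring A is given by its coefficient
-- vector  a : Fin (suc m) → A,  a i = coefficient of x^i.
-- A polynomial with fewer than n coefficients (degree < n) is  Fin n → A.

coeff : ∀ {A : Set} {N : ℕ} → A → (Fin N → A) → ℕ → A
coeff {N = N} z v k with k <? N
... | yes k<N = v (fromℕ< k<N)
... | no  _   = z

L : ∀ {m} → (Fin (suc m) → ℤ) → ℤ
L {m} f = coeff (ℤ.+ 0) f m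

sumFin : ∀ {n} → (Fin n → ℤ) → ℤ
sumFin {zero}  h = ℤ.+ 0
sumFin {suc n} h = h zero ℤ.+ sumFin (λ i → h (suc i))

sgn : ℕ → ℤ
sgn zero    = ℤ.+ 1
sgn (suc k) = ℤ.- sgn k

det : ∀ {n} → (Fin n → Fin n → ℤ) → ℤ
det {zero}  M = ℤ.+ 1
det {suc n} M = sumFin (λ j → sgn (toℕ j) ℤ.* (M zero j ℤ.* det (λ r c → M (suc r) (punchIn j c))))

-- Sylvester matrix and resultant of f (degree m) and g (degree n).
-- Rows 0..n-1: shifted coefficients of f (in decreasing powers);
-- rows n..n+m-1: shifted coefficients of g.

band : ∀ {d} → (Fin (suc d) → ℤ) → ℕ → ℕ → ℤ
band {d} a i j with i ≤? j | j ≤? i ℕ.+ d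
... | yes _ | yes _ = coeff (ℤ.+ 0) a (d ℕ.+ i ℕ.∸ j)
... | _     | _     = ℤ.+ 0

sylvesterEntry : ∀ {m n} → (Fin (suc m) → ℤ) → (Fin (suc n) → ℤ) → ℕ → ℕ → ℤ
sylvesterEntry {m} {n} f g r c with r <? n
... | yes _ = band f r c
... | no  _ = band g (r ℕ.∸ n) c

sylvester : ∀ {m n} → (Fin (suc m) → ℤ) → (Fin (suc n) → ℤ) → Fin (m ℕ.+ n) → Fin (m ℕ.+ n) → ℤ
sylvester f g r c = sylvesterEntry f g (toℕ r) (toℕ c)

Res : ∀ {m n} → (Fin (suc m) → ℤ) → (Fin (suc n) → ℤ) → ℤ
Res f g = det (sylvester f g)

R : ∀ {m n} → (Fin (suc m) → ℤ) → (Fin (suc n) → ℤ) → ℕ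
R f g = ∣ Res f g ∣

toℚ : ℤ → ℚ
toℚ z = z ℚ./ 1

sumUpTo : ℕ → (ℕ → ℚ) → ℚ
sumUpTo zero    h = h 0
sumUpTo (suc k) h = sumUpTo k h ℚ.+ h (suc k)

conv : (ℕ → ℚ) → (ℕ → ℚ) → ℕ → ℚ
conv a b k = sumUpTo k (λ i → a i ℚ.* b (k ℕ.∸ i))

one : ℕ → ℚ
one zero    = 1ℚ
one (suc _) = 0ℚ

IsBezout : ∀ {m n} → (Fin (suc m) → ℤ) → (Fin (suc n) → ℤ) → (Fin n → ℚ) → (Fin m → ℚ) → Set
IsBezout f g p q = ∀ k →
  conv (coeff 0ℚ p) (λ i → toℚ (coeff (ℤ.+ 0) f i)) k
    ℚ.+ conv (coeff 0ℚ q) (λ i → toℚ (coeff (ℤ.+ 0) g i)) k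
  ≡ one k
  where open import Relation.Binary.PropositionalEquality using (_≡_)

lcmFin : ∀ {n} → (Fin n → ℕ) → ℕ
lcmFin {zero}  h = 1
lcmFin {suc n} h = lcm (h zero) (lcmFin (λ i → h (suc i)))

B : ∀ {m n} → (Fin n → ℚ) → (Fin m → ℚ) → ℕ
B p q = lcm (lcmFin (λ i → ↧ₙ p i)) (lcmFin (λ i → ↧ₙ q i))

gcdL : ∀ {m n} → (Fin (suc m) → ℤ) → (Fin (suc n) → ℤ) → ℕ
gcdL f g = gcd ∣ L f ∣ ∣ L g ∣

{-# OPTIONS --safe #-}
-- Let a = L f. The rows of the Sylvester matrix span the lattice of all W f + V g with deg W < n and
-- deg V < m. Clearing denominators in p f + q g = 1 gives P f + Q g = B, so B lies in this lattice.
-- So does B ω for each quotient ω = f div x^k with 0 < k < m: ω Q is congruent modulo f to an integer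
-- polynomial of degree < m although f need not be monic, because x^k ω ≡ − (f mod x^k).
-- These m elements have degrees 0, …, m − 1 and leading coefficients B, B a, …, B a; together with
-- f, x f, …, x^(n−1) f they form a triangular matrix of determinant ± a^(m+n−1) B^m, which the resultant
-- therefore divides. By symmetry it also divides L(g)^(m+n−1) B^n.
module Submission where

open import Defs
open import Data.Product using (_×_; _,_; proj₁; proj₂; ∃-syntax; Σ-syntax)
open import Data.Sum using (inj₁; inj₂; [_,_]′)
open import Function using (_∘_)
open import Relation.Nullary using (yes; no; contradiction)

-- Multiplying P f + Q g = B by x^j pushes the cofactor of g out of range, and reducing x^j Q modulo
-- f divides by up to a^j; clearing that would cost a quadratic number of factors a. The quotients ω
-- are the Horner polynomials of f: each costs a single a, whatever its degree. Their cofactor V is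
-- small by construction, whereas the bound on W has to be recovered from degrees in W f = B ω - V
-- g. Only divisibility of determinants is needed, so signs and the order of rows never matter, and
-- the exchange of f and g is free. The two bounds combine once both powers of B are raised to the
-- exponent max(m, n): a common divisor of a^e x and c^e x divides gcd(a, c)^e x. If f and g are
-- monic these factors are 1, and the bound with the smaller exponent can be used as it is.

module SylvesterLattice where

  open import Algebra using (CommutativeSemiring)
  open import Algebra.Structures.Biased using (isCommutativeSemiringˡ)
  open import Data.Fin as Fin using (Fin; zero; suc; toℕ; punchIn; _↑ˡ_; _↑ʳ_; reduce≥; fromℕ<)
  open import Data.Fin.Properties using (toℕ-fromℕ<; toℕ<n)
  open import Data.Integer as ℤ using (ℤ; 0ℤ; 1ℤ; _+_; _*_; -_; ∣_∣)
  import Data.Integer.Properties as ℤ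
  open import Algebra.Properties.AbelianGroup ℤ.+-0-abelianGroup using (inverseˡ-unique)
  open import Data.Integer.Divisibility.Signed using (_∣_; divides; ∣-refl; ∣-trans; ∣m∣n⇒∣m+n; ∣m⇒∣-m; ∣n⇒∣m*n; ∣⇒∣ᵤ)
  open import Data.Integer.Tactic.RingSolver using (solve-∀)
  open import Data.Nat as ℕ using (ℕ; zero; suc; _∸_; _^_; _≤_; _<_; z≤n; s≤s; _≤?_; _<?_)
  open import Data.Nat.Coprimality as Coprime using (Coprime; coprime-divisor; coprime-factors)
  import Data.Nat.Divisibility as ℕ
  open import Data.Nat.GCD using (gcd; gcd-greatest; gcd[m,n]∣m; gcd[m,n]∣n; gcd[m,n]≡0⇒m≡0)
  open import Data.Nat.LCM using (m∣lcm[m,n]; n∣lcm[m,n])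
  import Data.Nat.Properties as ℕ
  import Data.Nat.Tactic.RingSolver as ℕ-Solver
  open import Data.Rational as ℚ using (ℚ; 0ℚ; ↥_; ↧_; ↧ₙ_; toℚᵘ)
  import Data.Rational.Properties as ℚ
  open import Data.Rational.Unnormalised as ℚᵘ using (mkℚᵘ; *≡*)
  import Data.Rational.Unnormalised.Properties as ℚᵘ
  open import Data.Unit using (⊤; tt)
  open import Data.Vec using (Vec; []; _∷_; _++_; lookup; removeAt)
  open import Data.Vec.Properties using (lookup-++ˡ; lookup-++ʳ; lookup-++-<; lookup-++-≥; removeAt-punchOut)
  open import Data.Vec.Relation.Binary.Pointwise.Inductive using (Pointwise)
  open import Data.Vec.Relation.Unary.All as All using (All; []; _∷_)
  open import Data.Vec.Relation.Unary.All.Properties using () renaming (++⁺ to All-++⁺; lookup⁺ to All-lookup⁺)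
  open import Level using (0ℓ)
  open import Relation.Binary using (IsEquivalence)
  open import Relation.Binary.PropositionalEquality

  -- Multilinear alternating functions

  -- Integer power series, indexed by exponent; a polynomial is a Seq that is Below some degree bound.
  Seq : Set
  Seq = ℕ → ℤ

  infix 4 _≈_
  infixl 6 _⊕_
  infixr 7 _·_

  _≈_ : Seq → Seq → Set
  a ≈ b = ∀ k → a k ≡ b k

  _⊕_ : Seq → Seq → Seq
  (a ⊕ b) k = a k + b k

  _·_ : ℤ → Seq → Seq
  (c · a) k = c * a k

  -- Sequences are functions compared pointwise, so compatibility with `≈` has to be a field.
  record Linear (φ : Seq → ℤ) : Set where
    field
      ≈-resp : ∀ {a b} → a ≈ b → φ a ≡ φ b
      ⊕-homo : ∀ a b → φ (a ⊕ b) ≡ φ a + φ b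
      ·-homo : ∀ c a → φ (c · a) ≡ c * φ a

    0-homo : φ (λ _ → 0ℤ) ≡ 0ℤ
    0-homo = trans (≈-resp (λ k → sym (ℤ.*-zeroˡ 0ℤ))) (trans (·-homo 0ℤ (λ _ → 0ℤ)) (ℤ.*-zeroˡ (φ (λ _ → 0ℤ))))

  open Linear

  VanishesOnDiagonal : ∀ n → (Vec Seq n → ℤ) → Set
  VanishesOnDiagonal (suc (suc n)) F = ∀ v w → F (v ∷ v ∷ w) ≡ 0ℤ
  VanishesOnDiagonal _             F = ⊤

  -- Curried form: the diagonal condition concerns the first two arguments only, and the recursive
  -- clause carries it to every later adjacent pair. Pairs further apart follow by swapping.
  Alternating : ∀ n → (Vec Seq n → ℤ) → Set
  Alternating zero    F = ⊤
  Alternating (suc n) F = (∀ w → Linear (λ v → F (v ∷ w)))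
                        × (∀ v → Alternating n (λ w → F (v ∷ w)))
                        × VanishesOnDiagonal (suc n) F

  -- Polarisation: expand F (u ⊕ v ∷ u ⊕ v ∷ w) ≡ 0.
  swap-first : ∀ n F → Alternating (suc (suc n)) F → ∀ u v w → F (u ∷ v ∷ w) ≡ - F (v ∷ u ∷ w)
  swap-first n F (lin , alt , diag) u v w = inverseˡ-unique (F (u ∷ v ∷ w)) (F (v ∷ u ∷ w)) (begin
    F (u ∷ v ∷ w) + F (v ∷ u ∷ w)
      ≡⟨ id₁ (F (u ∷ v ∷ w)) (F (v ∷ u ∷ w)) ⟩
    (0ℤ + F (u ∷ v ∷ w)) + (F (v ∷ u ∷ w) + 0ℤ)
      ≡⟨ cong₂ (λ x y → (x + F (u ∷ v ∷ w)) + (F (v ∷ u ∷ w) + y)) (diag u w) (diag v w) ⟨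
    (F (u ∷ u ∷ w) + F (u ∷ v ∷ w)) + (F (v ∷ u ∷ w) + F (v ∷ v ∷ w))
      ≡⟨ cong₂ _+_ (⊕-homo (lin₂ u) u v) (⊕-homo (lin₂ v) u v) ⟨
    F (u ∷ (u ⊕ v) ∷ w) + F (v ∷ (u ⊕ v) ∷ w)
      ≡⟨ ⊕-homo (lin ((u ⊕ v) ∷ w)) u v ⟨
    F ((u ⊕ v) ∷ (u ⊕ v) ∷ w)
      ≡⟨ diag (u ⊕ v) w ⟩
    0ℤ ∎)
    where
    open ≡-Reasoning
    lin₂ : ∀ x → Linear (λ y → F (x ∷ y ∷ w))
    lin₂ x = proj₁ (alt x) w
    id₁ : ∀ x y → x + y ≡ (0ℤ + x) + (y + 0ℤ)
    id₁ = solve-∀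

  VanishesAt : ∀ n → Seq → (Vec Seq n → ℤ) → Set
  VanishesAt zero    v F = ⊤
  VanishesAt (suc n) v F = (∀ w → F (v ∷ w) ≡ 0ℤ) × (∀ u → VanishesAt n v (λ w → F (u ∷ w)))

  VanishesAt-neg : ∀ n {v F G} → (∀ w → F w ≡ - G w) → VanishesAt n v G → VanishesAt n v F
  VanishesAt-neg zero    F≡-G _ = tt
  VanishesAt-neg (suc n) F≡-G (z , s) =
    (λ w → trans (F≡-G _) (cong -_ (z w))) , λ u → VanishesAt-neg n (λ w → F≡-G (u ∷ w)) (s u)

  -- A repetition of `v` right after the first place is the diagonal case. For a later place,
  -- `swap-first` exchanges the leading `v` with its neighbour `u` at the cost of a sign, and
  -- induction applies with `u` fixed.
  alternating-vanishes : ∀ n F → Alternating (suc n) F → ∀ v → VanishesAt n v (λ w → F (v ∷ w))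
  alternating-vanishes zero    F alt v = tt
  alternating-vanishes (suc n) F alt@(_ , alt′ , diag) v =
    diag v , λ u → VanishesAt-neg n (swap-first n F alt v u) (alternating-vanishes n (λ w → F (u ∷ w)) (alt′ u) v)

  -- Modulo the integer multiples of the one sequence `v`, not modulo the ideal that it generates.
  CongruentMod : Seq → Seq → Seq → Set
  CongruentMod v a b = ∃[ c ] a ≈ b ⊕ c · v

  -- The arguments are replaced one at a time; by linearity each replacement adds a multiple of a
  -- value with `v` among the arguments, which is zero.
  vanishing-resp-mod : ∀ n F {v} → Alternating n F → VanishesAt n v F →
    ∀ {w w′} → Pointwise (CongruentMod v) w w′ → F w ≡ F w′
  vanishing-resp-mod zero    F _ _ Pointwise.[] = refl
  vanishing-resp-mod (suc n) F {v} (lin , alt , _) (z , s) {a ∷ w} {b ∷ w′} ((c , a≈) Pointwise.∷ w~) = begin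
    F (a ∷ w)                   ≡⟨ ≈-resp (lin w) a≈ ⟩
    F ((b ⊕ c · v) ∷ w)         ≡⟨ ⊕-homo (lin w) b (c · v) ⟩
    F (b ∷ w) + F ((c · v) ∷ w) ≡⟨ cong (F (b ∷ w) +_) (trans (·-homo (lin w) c v) (cong (c *_) (z w))) ⟩
    F (b ∷ w) + c * 0ℤ          ≡⟨ cong (F (b ∷ w) +_) (ℤ.*-zeroʳ c) ⟩
    F (b ∷ w) + 0ℤ              ≡⟨ ℤ.+-identityʳ _ ⟩
    F (b ∷ w)                   ≡⟨ vanishing-resp-mod n (λ w → F (b ∷ w)) (alt b) (s b) w~ ⟩
    F (b ∷ w′)                  ∎
    where open ≡-Reasoning

  -- A closure under operations instead of coefficient vectors: facts about spans become inductions
  -- on derivations, and no transition matrix appears.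
  data Span {n} (s : Vec Seq n) : Seq → Set where
    gen      : ∀ i → Span s (lookup s i)
    nil      : Span s (λ _ → 0ℤ)
    sum      : ∀ {a b} → Span s a → Span s b → Span s (a ⊕ b)
    scale    : ∀ c {a} → Span s a → Span s (c · a)
    ≈-closed : ∀ {a b} → a ≈ b → Span s a → Span s b

  linear-span-∣ : ∀ {n φ d} {s : Vec Seq n} → Linear φ → (∀ i → d ∣ φ (lookup s i)) →
    ∀ {a} → Span s a → d ∣ φ a
  linear-span-∣ lin d∣ (gen i)     = d∣ i
  linear-span-∣ {d = d} lin d∣ nil = subst (d ∣_) (sym (0-homo lin)) (divides 0ℤ refl)
  linear-span-∣ {d = d} lin d∣ (sum {a} {b} p q) =
    subst (d ∣_) (sym (⊕-homo lin a b)) (∣m∣n⇒∣m+n (linear-span-∣ lin d∣ p) (linear-span-∣ lin d∣ q))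
  linear-span-∣ {d = d} lin d∣ (scale c {a} p) =
    subst (d ∣_) (sym (·-homo lin c a)) (∣n⇒∣m*n c (linear-span-∣ lin d∣ p))
  linear-span-∣ {d = d} lin d∣ (≈-closed a≈b p) = subst (d ∣_) (≈-resp lin a≈b) (linear-span-∣ lin d∣ p)

  -- All multiples of the removed generator collect in the scalar of the congruence, which is
  -- harmless once that generator is itself an argument of an alternating function.
  span-removeAt : ∀ {n} (s : Vec Seq (suc n)) j {a} → Span s a →
    ∃[ b ] Span (removeAt s j) b × CongruentMod (lookup s j) a b
  span-removeAt s j (gen i) with j Fin.≟ i
  ... | yes refl = (λ _ → 0ℤ) , nil , 1ℤ , λ k → id₁ (lookup s j k)
    where
    id₁ : ∀ x → x ≡ 0ℤ + 1ℤ * x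
    id₁ = solve-∀
  ... | no j≢i = lookup s i , subst (Span _) (removeAt-punchOut s j≢i) (gen _) , 0ℤ ,
    λ k → id₂ (lookup s i k) (lookup s j k)
    where
    id₂ : ∀ x y → x ≡ x + 0ℤ * y
    id₂ = solve-∀
  span-removeAt s j nil = (λ _ → 0ℤ) , nil , 0ℤ , λ k → id₁ (lookup s j k)
    where
    id₁ : ∀ x → 0ℤ ≡ 0ℤ + 0ℤ * x
    id₁ = solve-∀
  span-removeAt s j (sum p q) with span-removeAt s j p | span-removeAt s j q
  ... | b , b∈ , c , eq | b′ , b′∈ , c′ , eq′ =
    b ⊕ b′ , sum b∈ b′∈ , c + c′ , λ k → trans (cong₂ _+_ (eq k) (eq′ k)) (id₁ (b k) (b′ k) c c′ (lookup s j k))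
    where
    id₁ : ∀ b b′ c c′ x → (b + c * x) + (b′ + c′ * x) ≡ (b + b′) + (c + c′) * x
    id₁ = solve-∀
  span-removeAt s j (scale e p) with span-removeAt s j p
  ... | b , b∈ , c , eq =
    e · b , scale e b∈ , e * c , λ k → trans (cong (e *_) (eq k)) (id₁ (b k) c e (lookup s j k))
    where
    id₁ : ∀ b c e x → e * (b + c * x) ≡ e * b + e * c * x
    id₁ = solve-∀
  span-removeAt s j (≈-closed a≈ p) with span-removeAt s j p
  ... | b , b∈ , c , eq = b , b∈ , c , λ k → trans (sym (a≈ k)) (eq k)

  all-span-removeAt : ∀ {n m} (s : Vec Seq (suc n)) j {w : Vec Seq m} → All (Span s) w →
    Σ[ w′ ∈ Vec Seq m ] All (Span (removeAt s j)) w′ × Pointwise (CongruentMod (lookup s j)) w w′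
  all-span-removeAt s j []       = [] , [] , Pointwise.[]
  all-span-removeAt s j (p ∷ ps) with span-removeAt s j p | all-span-removeAt s j ps
  ... | b , b∈ , b~ | w′ , w′∈ , w~ = b ∷ w′ , b∈ ∷ w′∈ , b~ Pointwise.∷ w~

  -- Divisibility absorbs the sign of the permutation.
  ∣-move-to-front : ∀ n F → Alternating (suc n) F → ∀ s j → F s ∣ F (lookup s j ∷ removeAt s j)
  ∣-move-to-front n F alt (x ∷ s)     zero    = ∣-refl
  ∣-move-to-front (suc n) F alt@(_ , alt′ , _) (x ∷ s@(_ ∷ _)) (suc j) =
    subst (F (x ∷ s) ∣_) (sym (swap-first n F alt (lookup s j) x (removeAt s j)))
      (∣m⇒∣-m (∣-move-to-front n (λ w → F (x ∷ w)) (alt′ x) s j))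

  -- Expanding the first row of M reduces to first rows s_j; the other rows may then be taken modulo s_j,
  -- hence in the span of the remaining rows of s.
  alternating-span-∣ : ∀ n F → Alternating n F → ∀ s {M} → All (Span s) M → F s ∣ F M
  alternating-span-∣ zero    F _ [] [] = ∣-refl
  alternating-span-∣ (suc n) F alt@(lin , alt′ , _) s {M₀ ∷ M} (M₀∈ ∷ M∈) =
    linear-span-∣ (lin M) through-row M₀∈
    where
    through-row : ∀ j → F s ∣ F (lookup s j ∷ M)
    through-row j with all-span-removeAt s j M∈
    ... | M′ , M′∈ , M~M′ =
      subst (F s ∣_)
        (sym (vanishing-resp-mod n (λ w → F (lookup s j ∷ w)) (alt′ (lookup s j))
          (alternating-vanishes n F alt (lookup s j)) M~M′))
        (∣-trans (∣-move-to-front n F alt s j)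
          (alternating-span-∣ n (λ w → F (lookup s j ∷ w)) (alt′ (lookup s j)) (removeAt s j) M′∈))

  -- Determinants are alternating

  sumFin-cong : ∀ {n} {f g : Fin n → ℤ} → (∀ i → f i ≡ g i) → sumFin f ≡ sumFin g
  sumFin-cong {zero}  f≡g = refl
  sumFin-cong {suc n} f≡g = cong₂ _+_ (f≡g zero) (sumFin-cong (f≡g ∘ suc))

  sumFin-zero : ∀ {n} {f : Fin n → ℤ} → (∀ i → f i ≡ 0ℤ) → sumFin f ≡ 0ℤ
  sumFin-zero {zero}  f≡0 = refl
  sumFin-zero {suc n} f≡0 = cong₂ _+_ (f≡0 zero) (sumFin-zero (f≡0 ∘ suc))

  sumFin-+ : ∀ {n} (f g : Fin n → ℤ) → sumFin (λ i → f i + g i) ≡ sumFin f + sumFin g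
  sumFin-+ {zero}  f g = refl
  sumFin-+ {suc n} f g = trans (cong (f zero + g zero +_) (sumFin-+ (f ∘ suc) (g ∘ suc))) (id₁ (f zero) (g zero) _ _)
    where
    id₁ : ∀ a b c d → (a + b) + (c + d) ≡ (a + c) + (b + d)
    id₁ = solve-∀

  sumFin-* : ∀ {n} c (f : Fin n → ℤ) → sumFin (λ i → c * f i) ≡ c * sumFin f
  sumFin-* {zero}  c f = sym (ℤ.*-zeroʳ c)
  sumFin-* {suc n} c f = trans (cong (c * f zero +_) (sumFin-* c (f ∘ suc))) (sym (ℤ.*-distribˡ-+ c (f zero) _))

  scale-linear : ∀ c {φ} → Linear φ → Linear (λ v → c * φ v)
  scale-linear c lin .≈-resp a≈b = cong (c *_) (≈-resp lin a≈b)
  scale-linear c lin .⊕-homo a b = trans (cong (c *_) (⊕-homo lin a b)) (ℤ.*-distribˡ-+ c _ _)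
  scale-linear c {φ} lin .·-homo e a = trans (cong (c *_) (·-homo lin e a)) (id₁ c e (φ a))
    where
    id₁ : ∀ c e x → c * (e * x) ≡ e * (c * x)
    id₁ = solve-∀

  sum-linear : ∀ {k} {φ : Fin k → Seq → ℤ} → (∀ j → Linear (φ j)) → Linear (λ v → sumFin (λ j → φ j v))
  sum-linear lin .≈-resp a≈b = sumFin-cong (λ j → ≈-resp (lin j) a≈b)
  sum-linear {φ = φ} lin .⊕-homo a b =
    trans (sumFin-cong (λ j → ⊕-homo (lin j) a b)) (sumFin-+ (λ j → φ j a) (λ j → φ j b))
  sum-linear {φ = φ} lin .·-homo c a =
    trans (sumFin-cong (λ j → ·-homo (lin j) c a)) (sumFin-* c (λ j → φ j a))

  scale-alternating : ∀ n c {F} → Alternating n F → Alternating n (λ w → c * F w)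
  scale-alternating zero    c alt = tt
  scale-alternating (suc n) c (lin , alt , diag) =
    (λ w → scale-linear c (lin w)) , (λ v → scale-alternating n c (alt v)) , diagonal n diag
    where
    diagonal : ∀ n {F} → VanishesOnDiagonal (suc n) F → VanishesOnDiagonal (suc n) (λ w → c * F w)
    diagonal zero    _ = tt
    diagonal (suc n) z = λ v w → trans (cong (c *_) (z v w)) (ℤ.*-zeroʳ c)

  sum-alternating : ∀ n {k} {F : Fin k → Vec Seq n → ℤ} →
    (∀ j → Alternating n (F j)) → Alternating n (λ w → sumFin (λ j → F j w))
  sum-alternating zero    alt = tt
  sum-alternating (suc n) alt =
    (λ w → sum-linear (λ j → proj₁ (alt j) w)) ,
    (λ v → sum-alternating n (λ j → proj₁ (proj₂ (alt j)) v)) ,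
    diagonal n (λ j → proj₂ (proj₂ (alt j)))
    where
    diagonal : ∀ n {k} {F : Fin k → Vec Seq (suc n) → ℤ} →
      (∀ j → VanishesOnDiagonal (suc n) (F j)) → VanishesOnDiagonal (suc n) (λ w → sumFin (λ j → F j w))
    diagonal zero    _ = tt
    diagonal (suc n) z = λ v w → sumFin-zero (λ j → z j v w)

  det-cong : ∀ {n} {M N : Fin n → Fin n → ℤ} → (∀ r c → M r c ≡ N r c) → det M ≡ det N
  det-cong {zero}  M≡N = refl
  det-cong {suc n} M≡N = sumFin-cong λ j → cong (sgn (toℕ j) *_)
    (cong₂ _*_ (M≡N zero j) (det-cong λ r c → M≡N (suc r) (punchIn j c)))

  Extensional : ∀ {k l} → ((Fin k → Fin l) → ℤ) → Set
  Extensional h = ∀ {σ τ} → (∀ c → σ c ≡ τ c) → h σ ≡ h τ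

  -- The terms with j or k equal to zero cancel against each other; the others form the same sum one
  -- size down, because punchIn (suc j) ∘ suc and suc ∘ punchIn j agree definitionally.
  double-expansion-vanishes : ∀ n (u : Fin (suc (suc n)) → ℤ) (h : (Fin n → Fin (suc (suc n))) → ℤ) →
    Extensional h →
    sumFin (λ j → sgn (toℕ j) * (u j *
      sumFin (λ k → sgn (toℕ k) * (u (punchIn j k) * h (λ c → punchIn j (punchIn k c)))))) ≡ 0ℤ

  away-from-first-vanishes : ∀ n (u : Fin (suc (suc n)) → ℤ) (h : (Fin n → Fin (suc (suc n))) → ℤ) →
    Extensional h →
    sumFin (λ j → - sgn (toℕ j) * (u (suc j) *
      sumFin (λ k → - sgn (toℕ k) * (u (suc (punchIn j k)) * h (λ c → punchIn (suc j) (punchIn (suc k) c)))))) ≡ 0ℤ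

  double-expansion-vanishes n u h h-cong = begin
    1ℤ * (u₀ * A) + sumFin (λ j → - sgn (toℕ j) * (u (suc j) * (1ℤ * (u₀ * H j) + X j)))
      ≡⟨ cong (1ℤ * (u₀ * A) +_) (sumFin-cong λ j → id₁ (sgn (toℕ j)) (u (suc j)) u₀ (H j) (X j)) ⟩
    1ℤ * (u₀ * A) + sumFin (λ j → - u₀ * (sgn (toℕ j) * (u (suc j) * H j)) + - sgn (toℕ j) * (u (suc j) * X j))
      ≡⟨ cong (1ℤ * (u₀ * A) +_) (sumFin-+ (λ j → - u₀ * (sgn (toℕ j) * (u (suc j) * H j)))
                                           (λ j → - sgn (toℕ j) * (u (suc j) * X j))) ⟩
    1ℤ * (u₀ * A) + (sumFin (λ j → - u₀ * (sgn (toℕ j) * (u (suc j) * H j)))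
                     + sumFin (λ j → - sgn (toℕ j) * (u (suc j) * X j)))
      ≡⟨ cong (1ℤ * (u₀ * A) +_) (cong₂ _+_ (sumFin-* (- u₀) (λ j → sgn (toℕ j) * (u (suc j) * H j)))
                                            (away-from-first-vanishes n u h h-cong)) ⟩
    1ℤ * (u₀ * A) + (- u₀ * A + 0ℤ)
      ≡⟨ id₂ u₀ A ⟩
    0ℤ ∎
    where
    open ≡-Reasoning
    u₀ = u zero
    H X : Fin (suc n) → ℤ
    -- Removing column zero and then `suc j`, or `suc j` and then zero, leaves the same columns, so
    -- `A` arises twice, with opposite signs.
    H j = h (λ c → suc (punchIn j c))
    X j = sumFin (λ k → - sgn (toℕ k) * (u (suc (punchIn j k)) * h (λ c → punchIn (suc j) (punchIn (suc k) c))))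
    A = sumFin (λ k → sgn (toℕ k) * (u (suc k) * H k))
    id₁ : ∀ s v x h X → - s * (v * (1ℤ * (x * h) + X)) ≡ - x * (s * (v * h)) + - s * (v * X)
    id₁ = solve-∀
    id₂ : ∀ x a → 1ℤ * (x * a) + (- x * a + 0ℤ) ≡ 0ℤ
    id₂ = solve-∀

  away-from-first-vanishes zero    u h _ = sumFin-zero {f = λ j → - sgn (toℕ j) * (u (suc j) * 0ℤ)} λ j →
    trans (cong (- sgn (toℕ j) *_) (ℤ.*-zeroʳ (u (suc j)))) (ℤ.*-zeroʳ (- sgn (toℕ j)))
  away-from-first-vanishes (suc n) u h h-cong = begin
    sumFin (λ j → - sgn (toℕ j) * (u (suc j) *
      sumFin (λ k → - sgn (toℕ k) * (u (suc (punchIn j k)) * h (λ c → punchIn (suc j) (punchIn (suc k) c))))))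
      ≡⟨ sumFin-cong (λ j → cong (λ y → - sgn (toℕ j) * (u (suc j) * y)) (sumFin-cong λ k → inner j k)) ⟩
    sumFin (λ j → - sgn (toℕ j) * (u (suc j) * sumFin (λ k → - 1ℤ * Y j k)))
      ≡⟨ sumFin-cong (λ j → trans
           (cong (λ y → - sgn (toℕ j) * (u (suc j) * y)) (sumFin-* (- 1ℤ) (Y j)))
           (id₂ (sgn (toℕ j)) (u (suc j)) (sumFin (Y j)))) ⟩
    sumFin (λ j → sgn (toℕ j) * (u (suc j) * sumFin (Y j)))
      ≡⟨ double-expansion-vanishes n (u ∘ suc) h′ (λ σ≡τ → h-cong λ { zero → refl ; (suc c) → cong suc (σ≡τ c) }) ⟩
    0ℤ ∎
    where
    open ≡-Reasoning
    h′ : (Fin n → Fin (suc (suc n))) → ℤ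
    -- If neither removed column is zero, column zero stays in front and only the selection of the
    -- others varies. The two extra signs cancel.
    h′ σ = h (Fin.lift 1 σ)
    Y : Fin (suc (suc n)) → Fin (suc n) → ℤ
    Y j k = sgn (toℕ k) * (u (suc (punchIn j k)) * h′ (λ c → punchIn j (punchIn k c)))
    id₁ : ∀ s x y → - s * (x * y) ≡ - 1ℤ * (s * (x * y))
    id₁ = solve-∀
    id₂ : ∀ s u y → - s * (u * (- 1ℤ * y)) ≡ s * (u * y)
    id₂ = solve-∀
    inner : ∀ j k → - sgn (toℕ k) * (u (suc (punchIn j k)) * h (λ c → punchIn (suc j) (punchIn (suc k) c)))
                ≡ - 1ℤ * Y j k
    inner j k = trans
      (cong (λ y → - sgn (toℕ k) * (u (suc (punchIn j k)) * y)) (h-cong λ { zero → refl ; (suc c) → refl }))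
      (id₁ (sgn (toℕ k)) (u (suc (punchIn j k))) (h′ (λ c → punchIn j (punchIn k c))))

  -- The column map is arbitrary so that the minors of the expansion, with columns
  -- `col ∘ punchIn j`, have the same form.
  columnDet : ∀ {n} → (Fin n → ℕ) → Vec Seq n → ℤ
  columnDet col w = det (λ r c → lookup w r (col c))

  columnDet-alternating : ∀ n (col : Fin n → ℕ) → Alternating n (columnDet col)
  columnDet-alternating zero    col = tt
  columnDet-alternating (suc n) col =
    (λ w → sum-linear (λ j → scale-linear (sgn (toℕ j)) (record
      { ≈-resp = λ a≈b → cong (_* minor j w) (a≈b (col j))
      ; ⊕-homo = λ a b → ℤ.*-distribʳ-+ (minor j w) (a (col j)) (b (col j))
      ; ·-homo = λ c a → ℤ.*-assoc c (a (col j)) (minor j w) }))) ,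
    (λ v → sum-alternating n (λ j → scale-alternating n (sgn (toℕ j))
      (scale-alternating n (v (col j)) (columnDet-alternating n (col ∘ punchIn j))))) ,
    diagonal n col
    where
    minor : ∀ j → Vec Seq n → ℤ
    minor j = columnDet (col ∘ punchIn j)
    diagonal : ∀ n (col : Fin (suc n) → ℕ) → VanishesOnDiagonal (suc n) (columnDet col)
    diagonal zero    col = tt
    diagonal (suc n) col v w = double-expansion-vanishes n (v ∘ col)
      (λ σ → columnDet (col ∘ σ) w) (λ σ≡τ → det-cong λ r c → cong (lookup w r ∘ col) (σ≡τ c))

  -- Power series arithmetic and degrees

  infixl 7 _⊛_

  tail : Seq → Seq
  tail a = a ∘ suc

  -- The Cauchy product through a b = a₀ b + x (tail a) b, so that proofs recurse on the left factor
  -- without finite sums.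
  _⊛_ : Seq → Seq → Seq
  (a ⊛ b) zero    = a 0 * b 0
  (a ⊛ b) (suc k) = a 0 * b (suc k) + (tail a ⊛ b) k

  𝟘 𝟙 : Seq
  𝟘 _       = 0ℤ
  𝟙 zero    = 1ℤ
  𝟙 (suc _) = 0ℤ

  ⊛-cong : ∀ {a a′ b b′} → a ≈ a′ → b ≈ b′ → a ⊛ b ≈ a′ ⊛ b′
  ⊛-cong a≈ b≈ zero    = cong₂ _*_ (a≈ 0) (b≈ 0)
  ⊛-cong a≈ b≈ (suc k) = cong₂ _+_ (cong₂ _*_ (a≈ 0) (b≈ (suc k))) (⊛-cong (a≈ ∘ suc) b≈ k)

  ⊛-zeroˡ : ∀ a → 𝟘 ⊛ a ≈ 𝟘
  ⊛-zeroˡ a zero    = refl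
  ⊛-zeroˡ a (suc k) = trans (ℤ.+-identityˡ _) (⊛-zeroˡ a k)

  ⊛-identityˡ : ∀ a → 𝟙 ⊛ a ≈ a
  ⊛-identityˡ a zero    = ℤ.*-identityˡ (a 0)
  ⊛-identityˡ a (suc k) = trans (cong₂ _+_ (ℤ.*-identityˡ (a (suc k))) (⊛-zeroˡ a k)) (ℤ.+-identityʳ _)

  ⊛-distribʳ-⊕ : ∀ c a b → (a ⊕ b) ⊛ c ≈ a ⊛ c ⊕ b ⊛ c
  ⊛-distribʳ-⊕ c a b zero    = ℤ.*-distribʳ-+ (c 0) (a 0) (b 0)
  ⊛-distribʳ-⊕ c a b (suc k) =
    trans (cong ((a 0 + b 0) * c (suc k) +_) (⊛-distribʳ-⊕ c (tail a) (tail b) k)) (id₁ (a 0) (b 0) (c (suc k)) _ _)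
    where
    id₁ : ∀ a b c x y → (a + b) * c + (x + y) ≡ (a * c + x) + (b * c + y)
    id₁ = solve-∀

  ·-⊛-assoc : ∀ c a b → (c · a) ⊛ b ≈ c · (a ⊛ b)
  ·-⊛-assoc c a b zero    = ℤ.*-assoc c (a 0) (b 0)
  ·-⊛-assoc c a b (suc k) = trans (cong (c * a 0 * b (suc k) +_) (·-⊛-assoc c (tail a) b k)) (id₁ c (a 0) (b (suc k)) _)
    where
    id₁ : ∀ c a b x → c * a * b + c * x ≡ c * (a * b + x)
    id₁ = solve-∀

  ⊛-sucʳ : ∀ a b k → (a ⊛ b) (suc k) ≡ a (suc k) * b 0 + (a ⊛ tail b) k
  ⊛-sucʳ a b zero    = ℤ.+-comm (a 0 * b 1) (a 1 * b 0)
  ⊛-sucʳ a b (suc k) = trans (cong (a 0 * b (suc (suc k)) +_) (⊛-sucʳ (tail a) b k))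
    (id₁ (a 0 * b (suc (suc k))) (a (suc (suc k)) * b 0) ((tail a ⊛ tail b) k))
    where
    id₁ : ∀ x y z → x + (y + z) ≡ y + (x + z)
    id₁ = solve-∀

  ⊛-comm : ∀ a b → a ⊛ b ≈ b ⊛ a
  ⊛-comm a b zero    = ℤ.*-comm (a 0) (b 0)
  ⊛-comm a b (suc k) = trans
    (cong₂ _+_ (ℤ.*-comm (a 0) (b (suc k))) (⊛-comm (tail a) b k))
    (sym (⊛-sucʳ b a k))

  ⊛-assoc : ∀ a b c → (a ⊛ b) ⊛ c ≈ a ⊛ (b ⊛ c)
  ⊛-assoc a b c zero    = ℤ.*-assoc (a 0) (b 0) (c 0)
  ⊛-assoc a b c (suc k) = begin
    a 0 * b 0 * c (suc k) + ((a 0 · tail b ⊕ tail a ⊛ b) ⊛ c) k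
      ≡⟨ cong (a 0 * b 0 * c (suc k) +_) (trans (⊛-distribʳ-⊕ c (a 0 · tail b) (tail a ⊛ b) k)
           (cong₂ _+_ (·-⊛-assoc (a 0) (tail b) c k) (⊛-assoc (tail a) b c k))) ⟩
    a 0 * b 0 * c (suc k) + (a 0 * (tail b ⊛ c) k + (tail a ⊛ (b ⊛ c)) k)
      ≡⟨ id₁ (a 0) (b 0) (c (suc k)) ((tail b ⊛ c) k) ((tail a ⊛ (b ⊛ c)) k) ⟩
    a 0 * (b 0 * c (suc k) + (tail b ⊛ c) k) + (tail a ⊛ (b ⊛ c)) k ∎
    where
    open ≡-Reasoning
    id₁ : ∀ a b c x y → a * b * c + (a * x + y) ≡ a * (b * c + x) + y
    id₁ = solve-∀

  ≈-isEquivalence : IsEquivalence _≈_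
  ≈-isEquivalence = record
    { refl  = λ _ → refl
    ; sym   = λ a≈b k → sym (a≈b k)
    ; trans = λ a≈b b≈c k → trans (a≈b k) (b≈c k)
    }

  seqSemiring : CommutativeSemiring 0ℓ 0ℓ
  seqSemiring = record
    { _≈_ = _≈_ ; _+_ = _⊕_ ; _*_ = _⊛_ ; 0# = 𝟘 ; 1# = 𝟙
    ; isCommutativeSemiring = isCommutativeSemiringˡ record
      { +-isCommutativeMonoid = record
        { isMonoid = record
          { isSemigroup = record
            { isMagma = record
              { isEquivalence = ≈-isEquivalence
              ; ∙-cong = λ a≈ b≈ k → cong₂ _+_ (a≈ k) (b≈ k) }
            ; assoc = λ a b c k → ℤ.+-assoc (a k) (b k) (c k) }
          ; identity = (λ a k → ℤ.+-identityˡ (a k)) , (λ a k → ℤ.+-identityʳ (a k)) }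
        ; comm = λ a b k → ℤ.+-comm (a k) (b k) }
      ; *-isCommutativeMonoid = record
        { isMonoid = record
          { isSemigroup = record
            { isMagma = record
              { isEquivalence = ≈-isEquivalence
              ; ∙-cong = ⊛-cong }
            ; assoc = ⊛-assoc }
          ; identity = ⊛-identityˡ , λ a k → trans (⊛-comm a 𝟙 k) (⊛-identityˡ a k) }
        ; comm = ⊛-comm }
      ; distribʳ = ⊛-distribʳ-⊕
      ; zeroˡ = ⊛-zeroˡ } }

  open CommutativeSemiring seqSemiring using () renaming (setoid to seqSetoid)

  Below : ℕ → Seq → Set
  Below n a = ∀ k → n ≤ k → a k ≡ 0ℤ

  Below-mono : ∀ {n n′ a} → n ≤ n′ → Below n a → Below n′ a
  Below-mono n≤n′ a< k n′≤k = a< k (ℕ.≤-trans n≤n′ n′≤k)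

  Below-⊕ : ∀ {n a b} → Below n a → Below n b → Below n (a ⊕ b)
  Below-⊕ a< b< k n≤k = cong₂ _+_ (a< k n≤k) (b< k n≤k)

  Below-· : ∀ {n} c {a} → Below n a → Below n (c · a)
  Below-· c a< k n≤k = trans (cong (c *_) (a< k n≤k)) (ℤ.*-zeroʳ c)

  ⊛-Below-0 : ∀ {a} → Below 0 a → ∀ b → a ⊛ b ≈ 𝟘
  ⊛-Below-0 a< b k = trans (⊛-cong {b = b} (λ i → a< i z≤n) (λ _ → refl) k) (⊛-zeroˡ b k)

  -- Degrees at most s - 1 and t - 1 give a product of degree at most s + t - 2; writing `suc k`
  -- avoids truncated subtraction. This sharp form is what keeps V below `m` later.
  ⊛-vanishes : ∀ s t {a b} → Below s a → Below t b → ∀ k → s ℕ.+ t ≤ suc k → (a ⊛ b) k ≡ 0ℤ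
  ⊛-vanishes zero    t {b = b} a< b< k _ = ⊛-Below-0 a< b k
  ⊛-vanishes (suc s) t {a} {b} a< b< zero (s≤s s+t≤0) =
    trans (cong (a 0 *_) (b< 0 (ℕ.≤-trans (ℕ.m≤n+m t s) s+t≤0))) (ℤ.*-zeroʳ (a 0))
  ⊛-vanishes (suc s) t {a} {b} a< b< (suc k) (s≤s s+t≤) = cong₂ _+_
    (trans (cong (a 0 *_) (b< (suc k) (ℕ.≤-trans (ℕ.m≤n+m t s) s+t≤))) (ℤ.*-zeroʳ (a 0)))
    (⊛-vanishes s t (λ i s≤i → a< (suc i) (s≤s s≤i)) b< k s+t≤)

  ⊛-leading : ∀ s t {a b} → Below (suc s) a → Below (suc t) b → (a ⊛ b) (s ℕ.+ t) ≡ a s * b t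
  ⊛-leading zero    zero    a< b< = refl
  ⊛-leading zero    (suc t) {a} {b} a< b< =
    trans (cong (a 0 * b (suc t) +_) (⊛-Below-0 (λ i _ → a< (suc i) (s≤s z≤n)) b t)) (ℤ.+-identityʳ _)
  ⊛-leading (suc s) t {a} {b} a< b< = trans
    (cong₂ _+_ (trans (cong (a 0 *_) (b< (suc (s ℕ.+ t)) (s≤s (ℕ.m≤n+m t s)))) (ℤ.*-zeroʳ (a 0)))
               (⊛-leading s t {tail a} {b} (λ i s<i → a< (suc i) (s≤s s<i)) b<))
    (ℤ.+-identityˡ _)

  -- A coefficient of W at the top index N ≥ n would give W f the nonzero coefficient W N * f m at N
  -- + m; so N can be lowered until it reaches n. Some finite bound N must be given, since W could
  -- otherwise be a power series such as an inverse of f.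
  cofactor-below : ∀ m n N {f W} → f m ≢ 0ℤ → Below (suc m) f → Below N W →
    Below (m ℕ.+ n) (W ⊛ f) → Below n W
  cofactor-below m n zero    fm≢0 f< W< Wf< = Below-mono z≤n W<
  cofactor-below m n (suc N) {f} {W} fm≢0 f< W< Wf< with n ℕ.≤? N
  ... | no  n≰N = Below-mono (ℕ.≰⇒> n≰N) W<
  ... | yes n≤N = cofactor-below m n N fm≢0 f< W<′ Wf<
    where
    WN*fm≡0 : W N * f m ≡ 0ℤ
    WN*fm≡0 = trans (sym (⊛-leading N m W< f<))
      (Wf< (N ℕ.+ m) (subst (m ℕ.+ n ≤_) (ℕ.+-comm m N) (ℕ.+-monoʳ-≤ m n≤N)))
    WN≡0 : W N ≡ 0ℤ
    WN≡0 with ℤ.i*j≡0⇒i≡0∨j≡0 (W N) WN*fm≡0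
    ... | inj₁ eq = eq
    ... | inj₂ eq = contradiction eq fm≢0
    W<′ : Below N W
    W<′ k N≤k with ℕ.m≤n⇒m<n∨m≡n N≤k
    ... | inj₁ N<k  = W< k N<k
    ... | inj₂ refl = WN≡0

  delay : Seq → Seq
  delay a zero    = 0ℤ
  delay a (suc k) = a k

  shift : ℕ → Seq → Seq
  shift zero    a = a
  shift (suc j) a = delay (shift j a)

  delay-cong : ∀ {a b} → a ≈ b → delay a ≈ delay b
  delay-cong a≈b zero    = refl
  delay-cong a≈b (suc k) = a≈b k

  shift-delay : ∀ j a → shift j (delay a) ≈ shift (suc j) a
  shift-delay zero    a = λ _ → refl
  shift-delay (suc j) a = delay-cong (shift-delay j a)

  delay-⊛ : ∀ a b → delay a ⊛ b ≈ delay (a ⊛ b)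
  delay-⊛ a b zero    = ℤ.*-zeroˡ (b 0)
  delay-⊛ a b (suc k) = trans (cong (_+ (a ⊛ b) k) (ℤ.*-zeroˡ (b (suc k)))) (ℤ.+-identityˡ _)

  shift-⊛ : ∀ j a → shift j a ≈ shift j 𝟙 ⊛ a
  shift-⊛ zero    a k = sym (⊛-identityˡ a k)
  shift-⊛ (suc j) a k = trans (delay-cong (shift-⊛ j a) k) (sym (delay-⊛ (shift j 𝟙) a k))

  Below-shift : ∀ j {n a} → Below n a → Below (j ℕ.+ n) (shift j a)
  Below-shift zero    a< = a<
  Below-shift (suc j) a< (suc k) (s≤s le) = Below-shift j a< k le

  shift-low : ∀ j a k → k < j → shift j a k ≡ 0ℤ
  shift-low (suc j) a zero    _         = refl
  shift-low (suc j) a (suc k) (s≤s k<j) = shift-low j a k k<j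

  shift-high : ∀ j a k → shift j a (j ℕ.+ k) ≡ a k
  shift-high zero    a k = refl
  shift-high (suc j) a k = shift-high j a k

  drop : ℕ → Seq → Seq
  drop j a k = a (j ℕ.+ k)

  take : ℕ → Seq → Seq
  take zero    a         = 𝟘
  take (suc j) a zero    = a 0
  take (suc j) a (suc k) = take j (tail a) k

  Below-drop : ∀ j {n a} → Below (j ℕ.+ n) a → Below n (drop j a)
  Below-drop j a< k n≤k = a< (j ℕ.+ k) (ℕ.+-monoʳ-≤ j n≤k)

  Below-take : ∀ j a → Below j (take j a)
  Below-take zero    a k       _         = refl
  Below-take (suc j) a (suc k) (s≤s j≤k) = Below-take j (tail a) k j≤k

  shift-drop-take : ∀ j a → a ≈ shift j (drop j a) ⊕ take j a
  shift-drop-take zero    a k       = sym (ℤ.+-identityʳ (a k))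
  shift-drop-take (suc j) a zero    = sym (ℤ.+-identityˡ (a 0))
  shift-drop-take (suc j) a (suc k) = shift-drop-take j (tail a) k

  -- Membership in the Sylvester lattice { W f + V g : deg W < n, deg V < m }.
  record Combination (m n : ℕ) (f g v : Seq) : Set where
    field
      {W V}   : Seq
      W-below : Below n W
      V-below : Below m V
      v≈      : v ≈ W ⊛ f ⊕ V ⊛ g

  -- With f = X ω + lo and Q = X Qh + Ql this is ω (P f + Q g) = (ω P + Qh g) f + (ω Ql − lo Qh) g;
  -- lo⁻ stands for − lo, which makes it a semiring identity up to the summand (lo + lo⁻) Qh g.
  drop-identity : ∀ X ω lo lo⁻ Qh Ql P g → lo ⊕ lo⁻ ≈ 𝟘 →
    ω ⊛ (P ⊛ (X ⊛ ω ⊕ lo) ⊕ (X ⊛ Qh ⊕ Ql) ⊛ g)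
    ≈ (ω ⊛ P ⊕ Qh ⊛ g) ⊛ (X ⊛ ω ⊕ lo) ⊕ (ω ⊛ Ql ⊕ lo⁻ ⊛ Qh) ⊛ g
  drop-identity X ω lo lo⁻ Qh Ql P g lo⊕lo⁻≈𝟘 = begin
    ω ⊛ (P ⊛ (X ⊛ ω ⊕ lo) ⊕ (X ⊛ Qh ⊕ Ql) ⊛ g)
      ≈⟨ CommutativeSemiring.+-identityʳ seqSemiring _ ⟨
    ω ⊛ (P ⊛ (X ⊛ ω ⊕ lo) ⊕ (X ⊛ Qh ⊕ Ql) ⊛ g) ⊕ 𝟘
      ≈⟨ CommutativeSemiring.+-congˡ seqSemiring {ω ⊛ (P ⊛ (X ⊛ ω ⊕ lo) ⊕ (X ⊛ Qh ⊕ Ql) ⊛ g)}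
           (λ k → trans (⊛-cong lo⊕lo⁻≈𝟘 (λ _ → refl) k) (⊛-zeroˡ (Qh ⊛ g) k)) ⟨
    ω ⊛ (P ⊛ (X ⊛ ω ⊕ lo) ⊕ (X ⊛ Qh ⊕ Ql) ⊛ g) ⊕ (lo ⊕ lo⁻) ⊛ (Qh ⊛ g)
      ≈⟨ solve 8 (λ X ω lo lo⁻ Qh Ql P g →
           ω :* (P :* (X :* ω :+ lo) :+ (X :* Qh :+ Ql) :* g) :+ (lo :+ lo⁻) :* (Qh :* g)
           := (ω :* P :+ Qh :* g) :* (X :* ω :+ lo) :+ (ω :* Ql :+ lo⁻ :* Qh) :* g)
           (λ _ → refl) X ω lo lo⁻ Qh Ql P g ⟩
    (ω ⊛ P ⊕ Qh ⊛ g) ⊛ (X ⊛ ω ⊕ lo) ⊕ (ω ⊛ Ql ⊕ lo⁻ ⊛ Qh) ⊛ g ∎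
    where
    open import Algebra.Solver.Ring.NaturalCoefficients.Default seqSemiring
    open import Relation.Binary.Reasoning.Setoid seqSetoid

  -- Here ω = f div x^k has degree i. The summands ω P and Qh g of W may each have degree n or more.
  -- But ω and V g both have degree below m + n, so W f has too, and `cofactor-below` turns this
  -- into a bound on W.
  drop-combination : ∀ i k n {β f g P Q} → f (i ℕ.+ k) ≢ 0ℤ →
    Below (suc (i ℕ.+ k)) f → Below (suc n) g → Below n P → Below (i ℕ.+ k) Q →
    P ⊛ f ⊕ Q ⊛ g ≈ β · 𝟙 → 1 ≤ k → Combination (i ℕ.+ k) n f g (β · drop k f)
  drop-combination i k n {β} {f} {g} {P} {Q} fm≢0 f< g< P< Q< bezout 1≤k = record
    -- Any finite a priori bound will do; this one is a crude sum of the bounds for the two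
    -- summands.
    { W-below = cofactor-below m n ((suc i ℕ.+ n) ℕ.+ (i ℕ.+ suc n)) fm≢0 f<
        (Below-⊕ (Below-mono (ℕ.m≤m+n _ _) (Below-⊛ (suc i) n ω< P<))
                 (Below-mono (ℕ.m≤n+m _ (suc i ℕ.+ n)) (Below-⊛ i (suc n) Qh< g<)))
        Wf<
    ; V-below = V<
    ; v≈ = v≈
    }
    where
    m = i ℕ.+ k
    ω lo Qh Ql W V : Seq
    ω  = drop k f
    lo = take k f
    Qh = drop k Q
    Ql = take k Q
    W  = ω ⊛ P ⊕ Qh ⊛ g
    V  = ω ⊛ Ql ⊕ (- 1ℤ · lo) ⊛ Qh
    Below-⊛ : ∀ s t {a b} → Below s a → Below t b → Below (s ℕ.+ t) (a ⊛ b)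
    Below-⊛ s t a< b< k le = ⊛-vanishes s t a< b< k (ℕ.m≤n⇒m≤1+n le)
    ω< : Below (suc i) ω
    ω< = Below-drop k (subst (λ l → Below l f) (ℕ.+-comm (suc i) k) f<)
    Qh< : Below i Qh
    Qh< = Below-drop k (subst (λ l → Below l Q) (ℕ.+-comm i k) Q<)
    V< : Below m V
    V< l m≤l = cong₂ _+_
      (⊛-vanishes (suc i) k ω< (Below-take k Q) l (s≤s m≤l))
      (⊛-vanishes k i (Below-· (- 1ℤ) (Below-take k f)) Qh< l
        (ℕ.m≤n⇒m≤1+n (subst (_≤ l) (ℕ.+-comm i k) m≤l)))
    v≈ : β · ω ≈ W ⊛ f ⊕ V ⊛ g
    v≈ = begin
      β · ω ≈⟨ (λ j → cong (β *_) (⊛-identityˡ ω j)) ⟨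
      β · (𝟙 ⊛ ω) ≈⟨ ·-⊛-assoc β 𝟙 ω ⟨
      (β · 𝟙) ⊛ ω ≈⟨ ⊛-comm (β · 𝟙) ω ⟩
      ω ⊛ (β · 𝟙) ≈⟨ ⊛-cong {ω} (λ _ → refl) bezout ⟨
      ω ⊛ (P ⊛ f ⊕ Q ⊛ g)
        ≈⟨ ⊛-cong {ω} (λ _ → refl) (λ j → cong₂ _+_
             (⊛-cong {P} (λ _ → refl) (split f) j) (⊛-cong {b = g} (split Q) (λ _ → refl) j)) ⟩
      ω ⊛ (P ⊛ (shift k 𝟙 ⊛ ω ⊕ lo) ⊕ (shift k 𝟙 ⊛ Qh ⊕ Ql) ⊛ g)
        ≈⟨ drop-identity (shift k 𝟙) ω lo (- 1ℤ · lo) Qh Ql P g (λ j → id₁ (lo j)) ⟩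
      W ⊛ (shift k 𝟙 ⊛ ω ⊕ lo) ⊕ V ⊛ g
        ≈⟨ (λ j → cong (_+ (V ⊛ g) j) (⊛-cong {W} (λ _ → refl) (split f) j)) ⟨
      W ⊛ f ⊕ V ⊛ g ∎
      where
      open import Relation.Binary.Reasoning.Setoid seqSetoid
      split : ∀ a → a ≈ shift k 𝟙 ⊛ drop k a ⊕ take k a
      split a j = trans (shift-drop-take k a j) (cong (_+ take k a j) (shift-⊛ k (drop k a) j))
      id₁ : ∀ x → x + - 1ℤ * x ≡ 0ℤ
      id₁ = solve-∀
    Wf< : Below (m ℕ.+ n) (W ⊛ f)
    Wf< l m+n≤l = trans (sym (ℤ.+-identityʳ _)) (trans
      (cong ((W ⊛ f) l +_) (sym (⊛-vanishes m (suc n) V< g< l (subst (_≤ suc l) (sym (ℕ.+-suc m n)) (s≤s m+n≤l)))))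
      (trans (sym (v≈ l)) (Below-· β (Below-mono 1+i≤m+n ω<) l m+n≤l)))
      where
      -- As k ≥ 1, the degree i of ω is less than m.
      1+i≤m+n : suc i ≤ m ℕ.+ n
      1+i≤m+n = ℕ.≤-trans (subst (_≤ m) (ℕ.+-comm i 1) (ℕ.+-monoʳ-≤ i 1≤k)) (ℕ.m≤m+n m n)

  -- Triangular bases of the Sylvester lattice

  -- In the expansion along the first row, the first term contains an entry of the zero column and
  -- every other minor still has that column in front.
  det-zero-column : ∀ {n} (M : Fin (suc n) → Fin (suc n) → ℤ) → (∀ r → M r zero ≡ 0ℤ) → det M ≡ 0ℤ
  det-zero-column {n} M M₀≡0 = sumFin-zero {f = λ j → sgn (toℕ j) * (M zero j * minor j)} term
    where
    minor : Fin (suc n) → ℤ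
    minor j = det (λ r c → M (suc r) (punchIn j c))
    minor-zero : ∀ {n} (M : Fin (suc n) → Fin (suc n) → ℤ) → (∀ r → M r zero ≡ 0ℤ) →
      ∀ j → det (λ r c → M (suc r) (punchIn (suc j) c)) ≡ 0ℤ
    minor-zero {suc n} M M₀≡0 j = det-zero-column (λ r c → M (suc r) (punchIn (suc j) c)) (M₀≡0 ∘ suc)
    term : ∀ j → sgn (toℕ j) * (M zero j * minor j) ≡ 0ℤ
    term zero    = trans (ℤ.*-identityˡ _) (cong (_* minor zero) (M₀≡0 zero))
    term (suc j) = trans (cong (λ x → sgn (suc (toℕ j)) * (M zero (suc j) * x)) (minor-zero M M₀≡0 j))
      (trans (cong (sgn (suc (toℕ j)) *_) (ℤ.*-zeroʳ (M zero (suc j)))) (ℤ.*-zeroʳ (sgn (suc (toℕ j)))))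

  -- Column c of the Sylvester matrix holds the coefficients of x^(n − 1 − c).
  descending : ∀ {n} → Fin n → ℕ
  descending {n} c = n ∸ suc (toℕ c)

  coeffDet : ∀ {n} → Vec Seq n → ℤ
  coeffDet = columnDet descending

  -- The first column holds the coefficients of x^n, which vanish in all rows of `w`; only the minor
  -- that omits this column survives.
  coeffDet-staircase : ∀ {n} v (w : Vec Seq n) → All (Below n) w → coeffDet (v ∷ w) ≡ v n * coeffDet w
  coeffDet-staircase {n} v w w< = trans
    (cong (1ℤ * (v n * coeffDet w) +_)
      (sumFin-zero {f = λ j → - sgn (toℕ j) * (v (n ∸ suc (toℕ j)) * minor w j)} (term w w<)))
    (id₁ (v n * coeffDet w))
    where
    minor : ∀ {n} → Vec Seq n → Fin n → ℤ
    minor w j = det (λ r c → lookup w r (descending (punchIn (suc j) c)))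
    minor-zero : ∀ {n} (w : Vec Seq n) → All (Below n) w → ∀ j → minor w j ≡ 0ℤ
    minor-zero {suc n} w w< j = det-zero-column (λ r c → lookup w r (descending (punchIn (suc j) c)))
      (λ r → All-lookup⁺ w< r (suc n) ℕ.≤-refl)
    term : ∀ (w : Vec Seq n) → All (Below n) w → ∀ j → - sgn (toℕ j) * (v (n ∸ suc (toℕ j)) * minor w j) ≡ 0ℤ
    term w w< j = trans (cong (λ x → - sgn (toℕ j) * (v (n ∸ suc (toℕ j)) * x)) (minor-zero w w< j))
      (trans (cong (- sgn (toℕ j) *_) (ℤ.*-zeroʳ (v (n ∸ suc (toℕ j))))) (ℤ.*-zeroʳ (- sgn (toℕ j))))
    id₁ : ∀ x → 1ℤ * x + 0ℤ ≡ x
    id₁ = solve-∀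

  coeffDet-span-∣ : ∀ {M N} → M ≡ N → (s : Vec Seq M) {w : Vec Seq N} → All (Span s) w → coeffDet s ∣ coeffDet w
  coeffDet-span-∣ {N} refl s w∈ = alternating-span-∣ N coeffDet (columnDet-alternating N descending) s w∈

  shifts : ∀ n → Seq → Vec Seq n
  shifts zero    a = []
  shifts (suc n) a = shift n a ∷ shifts n a

  lookup-shifts : ∀ n a i → lookup (shifts n a) i ≡ shift (n ∸ suc (toℕ i)) a
  lookup-shifts (suc n) a zero    = refl
  lookup-shifts (suc n) a (suc i) = lookup-shifts n a i

  shifts-occurs : ∀ n a {j} → j < n → ∃[ i ] lookup (shifts n a) i ≡ shift j a
  shifts-occurs n a {j} j<n = i , trans (lookup-shifts n a i) (cong (λ x → shift x a) eq)
    where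
    i = fromℕ< {n ∸ suc j} (ℕ.∸-monoʳ-< {o = 0} (s≤s z≤n) j<n)
    eq : n ∸ suc (toℕ i) ≡ j
    eq = trans (cong (λ x → n ∸ suc x) (toℕ-fromℕ< _))
      (trans (cong (n ∸_) (sym (ℕ.+-∸-assoc 1 j<n))) (ℕ.m∸[m∸n]≡n (ℕ.<⇒≤ j<n)))

  all-shifts : ∀ n a {P : Seq → Set} → (∀ j → j < n → P (shift j a)) → All P (shifts n a)
  all-shifts zero    a p = []
  all-shifts (suc n) a p = p n ℕ.≤-refl ∷ all-shifts n a (λ j j<n → p j (ℕ.m≤n⇒m≤1+n j<n))

  -- With W a = W₀ a + (tail W) (x a), the induction passes to x a, whose shifts are those of `a`
  -- from the index 1 on.
  span-⊛ : ∀ {N} {s : Vec Seq N} n {W} a → Below n W → (∀ j → j < n → Span s (shift j a)) → Span s (W ⊛ a)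
  span-⊛ zero    a W< _ = ≈-closed (λ k → sym (⊛-Below-0 W< a k)) nil
  span-⊛ (suc n) {W} a W< s∋ = ≈-closed expand
    (sum (scale (W 0) (s∋ 0 (s≤s z≤n)))
         (span-⊛ n {tail W} (delay a) (λ k n≤k → W< (suc k) (s≤s n≤k))
           (λ j j<n → ≈-closed (λ k → sym (shift-delay j a k)) (s∋ (suc j) (s≤s j<n)))))
    where
    expand : W 0 · a ⊕ tail W ⊛ delay a ≈ W ⊛ a
    expand zero    = trans (cong (W 0 * a 0 +_) (ℤ.*-zeroʳ (W 1))) (ℤ.+-identityʳ _)
    expand (suc k) = cong (W 0 * a (suc k) +_) (trans (⊛-sucʳ (tail W) (delay a) k)
      (trans (cong (_+ (tail W ⊛ a) k) (ℤ.*-zeroʳ (W (suc (suc k))))) (ℤ.+-identityˡ _)))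

  span-combination : ∀ {N} {s : Vec Seq N} m n {f g v} →
    (∀ j → j < n → Span s (shift j f)) → (∀ j → j < m → Span s (shift j g)) →
    Combination m n f g v → Span s v
  span-combination m n {f} {g} s∋f s∋g comb =
    ≈-closed (λ k → sym (v≈ k)) (sum (span-⊛ n f W-below s∋f) (span-⊛ m g V-below s∋g))
    where open Combination comb

  shifts-staircase : ∀ n m {f} → Below (suc m) f → {w : Vec Seq m} → All (Below m) w →
    All (Below (n ℕ.+ m)) (shifts n f ++ w)
    × ∣ coeffDet (shifts n f ++ w) ∣ ≡ ∣ f m ∣ ^ n ℕ.* ∣ coeffDet w ∣
  shifts-staircase zero    m f< w< = w< , sym (ℕ.*-identityˡ _)
  shifts-staircase (suc n) m {f} f< {w} w< with shifts-staircase n m f< w<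
  ... | below , eq =
    subst (λ l → Below l (shift n f)) (ℕ.+-suc n m) (Below-shift n f<) ∷ All.map (Below-mono (ℕ.n≤1+n _)) below ,
    (begin
      ∣ coeffDet (shift n f ∷ (shifts n f ++ w)) ∣
        ≡⟨ cong ∣_∣ (coeffDet-staircase (shift n f) (shifts n f ++ w) below) ⟩
      ∣ shift n f (n ℕ.+ m) * coeffDet (shifts n f ++ w) ∣
        ≡⟨ ℤ.abs-* (shift n f (n ℕ.+ m)) _ ⟩
      ∣ shift n f (n ℕ.+ m) ∣ ℕ.* ∣ coeffDet (shifts n f ++ w) ∣
        ≡⟨ cong₂ (λ x y → ∣ x ∣ ℕ.* y) (shift-high n f m) eq ⟩
      ∣ f m ∣ ℕ.* (∣ f m ∣ ^ n ℕ.* ∣ coeffDet w ∣)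
        ≡⟨ ℕ.*-assoc (∣ f m ∣) (∣ f m ∣ ^ n) (∣ coeffDet w ∣) ⟨
      ∣ f m ∣ ^ suc n ℕ.* ∣ coeffDet w ∣ ∎)
    where open ≡-Reasoning

  -- Rows β · (f div x^(k+1)), …, β · (f div x^(k+i)), β, of degrees i, …, 1, 0 when deg f = i + 1 + k.
  -- The last row is β and not β times the leading coefficient, which saves one power of the latter.
  quotients : ∀ i → ℕ → ℤ → Seq → Vec Seq (suc i)
  quotients zero    k β f = β · 𝟙 ∷ []
  quotients (suc i) k β f = β · drop (suc k) f ∷ quotients i (suc k) β f

  quotients-staircase : ∀ i k β {f m} → suc i ℕ.+ k ≡ m → Below (suc m) f →
    All (Below (suc i)) (quotients i k β f)
    × ∣ coeffDet (quotients i k β f) ∣ ≡ (∣ β ∣ ℕ.* ∣ f m ∣) ^ i ℕ.* ∣ β ∣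
  quotients-staircase zero    k β {f} {m} eq f< =
    Below-· β (λ { zero () ; (suc _) _ → refl }) ∷ [] ,
    trans (cong ∣_∣ (id₁ β)) (sym (ℕ.*-identityˡ ∣ β ∣))
    where
    id₁ : ∀ x → 1ℤ * (x * 1ℤ * 1ℤ) + 0ℤ ≡ x
    id₁ = solve-∀
  quotients-staircase (suc i) k β {f} {m} eq f<
    with quotients-staircase i (suc k) β {f} {m} (trans (cong suc (ℕ.+-suc i k)) eq) f<
  ... | below , ih =
    Below-· β (Below-drop (suc k) (subst (λ l → Below l f) size f<)) ∷ All.map (Below-mono (ℕ.n≤1+n _)) below ,
    (begin
      ∣ coeffDet (β · drop (suc k) f ∷ quotients i (suc k) β f) ∣
        ≡⟨ cong ∣_∣ (coeffDet-staircase (β · drop (suc k) f) (quotients i (suc k) β f) below) ⟩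
      ∣ β * f (suc k ℕ.+ suc i) * coeffDet (quotients i (suc k) β f) ∣
        ≡⟨ trans (ℤ.abs-* (β * f (suc k ℕ.+ suc i)) _) (cong₂ ℕ._*_ (ℤ.abs-* β (f (suc k ℕ.+ suc i))) ih) ⟩
      ∣ β ∣ ℕ.* ∣ f (suc k ℕ.+ suc i) ∣ ℕ.* ((∣ β ∣ ℕ.* ∣ f m ∣) ^ i ℕ.* ∣ β ∣)
        ≡⟨ cong (λ l → ∣ β ∣ ℕ.* ∣ f l ∣ ℕ.* ((∣ β ∣ ℕ.* ∣ f m ∣) ^ i ℕ.* ∣ β ∣)) degree ⟩
      ∣ β ∣ ℕ.* ∣ f m ∣ ℕ.* ((∣ β ∣ ℕ.* ∣ f m ∣) ^ i ℕ.* ∣ β ∣)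
        ≡⟨ ℕ.*-assoc (∣ β ∣ ℕ.* ∣ f m ∣) ((∣ β ∣ ℕ.* ∣ f m ∣) ^ i) (∣ β ∣) ⟨
      (∣ β ∣ ℕ.* ∣ f m ∣) ^ suc i ℕ.* ∣ β ∣ ∎)
    where
    open ≡-Reasoning
    degree : suc k ℕ.+ suc i ≡ m
    degree = trans (swap k i) eq
      where
      swap : ∀ k i → suc k ℕ.+ suc i ≡ suc (suc i) ℕ.+ k
      swap = ℕ-Solver.solve-∀
    size : suc m ≡ suc k ℕ.+ suc (suc i)
    size = trans (cong suc (sym degree)) (sym (ℕ.+-suc (suc k) (suc i)))

  -- At i = m - 1 this is the exponent count: n factors `a` from the shifts of f and m - 1 from the
  -- quotients, with m factors `b`.
  collect-powers : ∀ a b i n → a ^ n ℕ.* ((b ℕ.* a) ^ i ℕ.* b) ≡ a ^ (i ℕ.+ n) ℕ.* b ^ suc i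
  collect-powers a b zero    n = id₁ (a ^ n) b
    where
    id₁ : ∀ x b → x ℕ.* (1 ℕ.* b) ≡ x ℕ.* (b ℕ.* 1)
    id₁ = ℕ-Solver.solve-∀
  collect-powers a b (suc i) n = begin
    a ^ n ℕ.* (b ℕ.* a ℕ.* (b ℕ.* a) ^ i ℕ.* b)   ≡⟨ id₁ a b (a ^ n) ((b ℕ.* a) ^ i) ⟩
    b ℕ.* a ℕ.* (a ^ n ℕ.* ((b ℕ.* a) ^ i ℕ.* b)) ≡⟨ cong (b ℕ.* a ℕ.*_) (collect-powers a b i n) ⟩
    b ℕ.* a ℕ.* (a ^ (i ℕ.+ n) ℕ.* b ^ suc i)     ≡⟨ id₂ a b (a ^ (i ℕ.+ n)) (b ^ suc i) ⟩
    a ^ (suc i ℕ.+ n) ℕ.* b ^ suc (suc i)         ∎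
    where
    open ≡-Reasoning
    id₁ : ∀ a b x y → x ℕ.* (b ℕ.* a ℕ.* y ℕ.* b) ≡ b ℕ.* a ℕ.* (x ℕ.* (y ℕ.* b))
    id₁ = ℕ-Solver.solve-∀
    id₂ : ∀ a b x y → b ℕ.* a ℕ.* (x ℕ.* y) ≡ a ℕ.* x ℕ.* (b ℕ.* y)
    id₂ = ℕ-Solver.solve-∀

  -- Only the span of `s` matters, not its order, so the Sylvester rows serve both for (f, g) and
  -- for (g, f).
  coeffDet-∣ : ∀ i n {β f g P Q} → f (suc i) ≢ 0ℤ →
    Below (suc (suc i)) f → Below (suc n) g → Below n P → Below (suc i) Q →
    P ⊛ f ⊕ Q ⊛ g ≈ β · 𝟙 →
    ∀ {N} {s : Vec Seq N} → N ≡ n ℕ.+ suc i →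
    (∀ j → j < n → Span s (shift j f)) → (∀ j → j < suc i → Span s (shift j g)) →
    ∣ coeffDet s ∣ ℕ.∣ ∣ f (suc i) ∣ ^ (i ℕ.+ n) ℕ.* ∣ β ∣ ^ suc i
  coeffDet-∣ i n {β} {f} {g} fm≢0 f< g< P< Q< bezout {s = s} N≡n+m s∋f s∋g
    with quotients-staircase i 0 β (ℕ.+-identityʳ (suc i)) f<
  ... | below , eq = subst (∣ coeffDet s ∣ ℕ.∣_)
    (trans (proj₂ (shifts-staircase n m f< below))
      (trans (cong (∣ f m ∣ ^ n ℕ.*_) eq) (collect-powers (∣ f m ∣) (∣ β ∣) i n)))
    (∣⇒∣ᵤ (coeffDet-span-∣ N≡n+m s (All-++⁺ (all-shifts n f s∋f) (span-quotients i 0 (ℕ.+-identityʳ m)))))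
    where
    m = suc i
    span-quotients : ∀ j k → suc j ℕ.+ k ≡ m → All (Span s) (quotients j k β f)
    -- The constant row β is the integral Bezout relation itself.
    span-quotients zero    k eq = span-combination m n s∋f s∋g
      (record { W-below = P< ; V-below = Q< ; v≈ = λ l → sym (bezout l) }) ∷ []
    span-quotients (suc j) k eq =
      span-combination m n s∋f s∋g (comb eq′) ∷ span-quotients j (suc k) eq′
      where
      eq′ : suc j ℕ.+ suc k ≡ m
      eq′ = trans (cong suc (ℕ.+-suc j k)) eq
      comb : suc j ℕ.+ suc k ≡ m → Combination m n f g (β · drop (suc k) f)
      comb refl = drop-combination (suc j) (suc k) n {β} fm≢0 f< g< P< Q< bezout (s≤s z≤n)

  -- The Sylvester matrix

  toSeq : ∀ {n} → (Fin n → ℤ) → Seq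
  toSeq = coeff 0ℤ

  coeff-below : ∀ {A : Set} {n} (z : A) (v : Fin n → A) k → n ≤ k → coeff z v k ≡ z
  coeff-below {n = n} z v k n≤k with k <? n
  ... | yes k<n = contradiction k<n (ℕ.≤⇒≯ n≤k)
  ... | no  _   = refl

  shifted-index : ∀ {l} j c k → c ≤ l → j ℕ.+ l ≡ k ℕ.+ c → j ℕ.+ (l ∸ c) ≡ k
  shifted-index {l} j c k c≤l eq = ℕ.+-cancelʳ-≡ c (j ℕ.+ (l ∸ c)) k
    (trans (ℕ.+-assoc j (l ∸ c) c) (trans (cong (j ℕ.+_) (ℕ.m∸n+n≡m c≤l)) eq))

  short-index : ∀ {l} j c k → l < c → j ℕ.+ l ≡ k ℕ.+ c → k < j
  short-index j c k l<c eq = ℕ.≰⇒> (λ j≤k → ℕ.<-irrefl eq (ℕ.+-mono-≤-< j≤k l<c))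

  -- The row is x^j a, with its leading coefficient in column `r`, and column `c` stands for x^k.
  -- Moving one column to the right lowers the power by one, so power plus column is constant; this
  -- is the hypothesis.
  band≡shift : ∀ {d} (a : Fin (suc d) → ℤ) r c j k → j ℕ.+ (d ℕ.+ r) ≡ k ℕ.+ c →
    band a r c ≡ shift j (toSeq a) k
  band≡shift {d} a r c j k eq with r ≤? c | c ≤? r ℕ.+ d
  ... | yes r≤c | yes c≤r+d = sym (trans (cong (shift j (toSeq a)) k≡) (shift-high j (toSeq a) (d ℕ.+ r ∸ c)))
    where
    k≡ : k ≡ j ℕ.+ (d ℕ.+ r ∸ c)
    k≡ = sym (shifted-index j c k (subst (c ≤_) (ℕ.+-comm r d) c≤r+d) eq)
  -- Left of the band the index into `a` exceeds `d`, where `coeff` takes its default value zero.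
  ... | no r≰c | yes c≤r+d = sym (trans (cong (shift j (toSeq a)) k≡)
      (trans (shift-high j (toSeq a) (d ℕ.+ r ∸ c))
        (coeff-below 0ℤ a (d ℕ.+ r ∸ c) (ℕ.m+n≤o⇒m≤o∸n (suc d)
          (subst (_≤ d ℕ.+ r) (ℕ.+-suc d c) (ℕ.+-monoʳ-≤ d (ℕ.≰⇒> r≰c)))))))
    where
    k≡ : k ≡ j ℕ.+ (d ℕ.+ r ∸ c)
    k≡ = sym (shifted-index j c k (subst (c ≤_) (ℕ.+-comm r d) c≤r+d) eq)
  -- Right of the band the power k is less than j, so x^j a has no such term.
  ... | yes r≤c | no c≰r+d =
    sym (shift-low j (toSeq a) k (short-index j c k (subst (_< c) (ℕ.+-comm r d) (ℕ.≰⇒> c≰r+d)) eq))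
  ... | no r≰c | no c≰r+d =
    sym (shift-low j (toSeq a) k (short-index j c k (subst (_< c) (ℕ.+-comm r d) (ℕ.≰⇒> c≰r+d)) eq))

  -- Both sides are n + m - 1.
  degree-balance : ∀ n m r c → r < n → c < n ℕ.+ m →
    (n ∸ suc r) ℕ.+ (m ℕ.+ r) ≡ (n ℕ.+ m ∸ suc c) ℕ.+ c
  degree-balance n m r c r<n c<n+m = ℕ.suc-injective (begin
    suc ((n ∸ suc r) ℕ.+ (m ℕ.+ r)) ≡⟨ id₁ (n ∸ suc r) m r ⟩
    (n ∸ suc r) ℕ.+ suc r ℕ.+ m     ≡⟨ cong (ℕ._+ m) (ℕ.m∸n+n≡m r<n) ⟩
    n ℕ.+ m                         ≡⟨ ℕ.m∸n+n≡m c<n+m ⟨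
    (n ℕ.+ m ∸ suc c) ℕ.+ suc c     ≡⟨ ℕ.+-suc _ c ⟩
    suc ((n ℕ.+ m ∸ suc c) ℕ.+ c)   ∎)
    where
    open ≡-Reasoning
    id₁ : ∀ x m r → suc (x ℕ.+ (m ℕ.+ r)) ≡ x ℕ.+ suc r ℕ.+ m
    id₁ = ℕ-Solver.solve-∀

  toℕ-reduce≥ : ∀ m {n} (i : Fin (m ℕ.+ n)) (m≤i : m ≤ toℕ i) → toℕ (reduce≥ i m≤i) ≡ toℕ i ∸ m
  toℕ-reduce≥ zero    i       _   = refl
  toℕ-reduce≥ (suc m) (suc i) m≤i = toℕ-reduce≥ m i (ℕ.s≤s⁻¹ m≤i)

  sylvester-lookup : ∀ {m n} (f : Fin (suc m) → ℤ) (g : Fin (suc n) → ℤ) (r c : Fin (n ℕ.+ m)) →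
    sylvesterEntry f g (toℕ r) (toℕ c) ≡ lookup (shifts n (toSeq f) ++ shifts m (toSeq g)) r (descending c)
  sylvester-lookup {m} {n} f g r c with toℕ r <? n
  ... | yes r<n = trans
    (band≡shift f (toℕ r) (toℕ c) (n ∸ suc (toℕ r)) (descending c) (degree-balance n m (toℕ r) (toℕ c) r<n (toℕ<n c)))
    (cong (λ a → a (descending c)) (sym (trans
      (lookup-++-< (shifts n (toSeq f)) (shifts m (toSeq g)) r r<n)
      (trans (lookup-shifts n (toSeq f) (fromℕ< r<n))
        (cong (λ x → shift (n ∸ suc x) (toSeq f)) (toℕ-fromℕ< r<n))))))
  ... | no r≮n = trans
    (band≡shift g (toℕ r ∸ n) (toℕ c) (m ∸ suc (toℕ r ∸ n)) (descending c) (trans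
      (degree-balance m n (toℕ r ∸ n) (toℕ c)
        (subst (_< m) (toℕ-reduce≥ n r n≤r) (toℕ<n (reduce≥ r n≤r))) (subst (toℕ c <_) (ℕ.+-comm n m) (toℕ<n c)))
      (cong (λ l → (l ∸ suc (toℕ c)) ℕ.+ toℕ c) (ℕ.+-comm m n))))
    (cong (λ a → a (descending c)) (sym (trans
      (lookup-++-≥ (shifts n (toSeq f)) (shifts m (toSeq g)) r n≤r)
      (trans (lookup-shifts m (toSeq g) (reduce≥ r n≤r))
        (cong (λ x → shift (m ∸ suc x) (toSeq g)) (toℕ-reduce≥ n r n≤r))))))
    where
    n≤r = ℕ.≮⇒≥ r≮n

  Res≡coeffDet : ∀ {m n} (f : Fin (suc m) → ℤ) (g : Fin (suc n) → ℤ) →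
    Res f g ≡ coeffDet (shifts n (toSeq f) ++ shifts m (toSeq g))
  Res≡coeffDet {m} {n} f g = trans
    -- Entries depend on natural number indices only, so the size m + n can be rewritten to n + m
    -- without transporting a matrix.
    (cong (λ N → det {N} (λ r c → sylvesterEntry f g (toℕ r) (toℕ c))) (ℕ.+-comm m n))
    (det-cong (sylvester-lookup f g))

  -- Clearing denominators

  toℚᵘ-toℚ : ∀ z → toℚᵘ (toℚ z) ℚᵘ.≃ mkℚᵘ z 0
  toℚᵘ-toℚ z = ℚ.toℚᵘ-fromℚᵘ (mkℚᵘ z 0)

  toℚ-injective : ∀ {y z} → toℚ y ≡ toℚ z → y ≡ z
  toℚ-injective {y} {z} eq with ℚᵘ.≃-trans (ℚᵘ.≃-sym (toℚᵘ-toℚ y)) (ℚᵘ.≃-trans (ℚ.toℚᵘ-cong eq) (toℚᵘ-toℚ z))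
  ... | *≡* y*1≡z*1 = trans (sym (ℤ.*-identityʳ y)) (trans y*1≡z*1 (ℤ.*-identityʳ z))

  toℚ-homo-+ : ∀ y z → toℚ (y + z) ≡ toℚ y ℚ.+ toℚ z
  toℚ-homo-+ y z = ℚ.toℚᵘ-injective (begin
    toℚᵘ (toℚ (y + z))                ≈⟨ toℚᵘ-toℚ (y + z) ⟩
    mkℚᵘ (y + z) 0                    ≈⟨ *≡* (id₁ y z) ⟩
    mkℚᵘ y 0 ℚᵘ.+ mkℚᵘ z 0            ≈⟨ ℚᵘ.+-cong (toℚᵘ-toℚ y) (toℚᵘ-toℚ z) ⟨
    toℚᵘ (toℚ y) ℚᵘ.+ toℚᵘ (toℚ z)    ≈⟨ ℚ.toℚᵘ-homo-+ (toℚ y) (toℚ z) ⟨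
    toℚᵘ (toℚ y ℚ.+ toℚ z)            ∎)
    where
    open ℚᵘ.≃-Reasoning
    id₁ : ∀ y z → (y + z) * 1ℤ ≡ (y * 1ℤ + z * 1ℤ) * 1ℤ
    id₁ = solve-∀

  toℚ-homo-* : ∀ y z → toℚ (y * z) ≡ toℚ y ℚ.* toℚ z
  toℚ-homo-* y z = ℚ.toℚᵘ-injective (begin
    toℚᵘ (toℚ (y * z))                ≈⟨ toℚᵘ-toℚ (y * z) ⟩
    mkℚᵘ (y * z) 0                    ≈⟨ *≡* refl ⟩
    mkℚᵘ y 0 ℚᵘ.* mkℚᵘ z 0            ≈⟨ ℚᵘ.*-cong (toℚᵘ-toℚ y) (toℚᵘ-toℚ z) ⟨
    toℚᵘ (toℚ y) ℚᵘ.* toℚᵘ (toℚ z)    ≈⟨ ℚ.toℚᵘ-homo-* (toℚ y) (toℚ z) ⟨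
    toℚᵘ (toℚ y ℚ.* toℚ z)            ∎)
    where open ℚᵘ.≃-Reasoning

  clear-denominator : ∀ b p → ↧ₙ p ℕ.∣ b → ∃[ z ] toℚ z ≡ toℚ (ℤ.+ b) ℚ.* p
  clear-denominator b p@(ℚ.mkℚ _ _ _) (ℕ.divides t b≡t*d) = ↥ p * ℤ.+ t , ℚ.toℚᵘ-injective (begin
    toℚᵘ (toℚ (↥ p * ℤ.+ t))          ≈⟨ toℚᵘ-toℚ (↥ p * ℤ.+ t) ⟩
    mkℚᵘ (↥ p * ℤ.+ t) 0              ≈⟨ *≡* cross ⟩
    mkℚᵘ (ℤ.+ b) 0 ℚᵘ.* toℚᵘ p        ≈⟨ ℚᵘ.*-congʳ {toℚᵘ p} (toℚᵘ-toℚ (ℤ.+ b)) ⟨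
    toℚᵘ (toℚ (ℤ.+ b)) ℚᵘ.* toℚᵘ p    ≈⟨ ℚ.toℚᵘ-homo-* (toℚ (ℤ.+ b)) p ⟨
    toℚᵘ (toℚ (ℤ.+ b) ℚ.* p)          ∎)
    where
    open ℚᵘ.≃-Reasoning
    cross : (↥ p * ℤ.+ t) * ℚᵘ.↧ (mkℚᵘ (ℤ.+ b) 0 ℚᵘ.* toℚᵘ p) ≡ (ℤ.+ b * ℚᵘ.↥ toℚᵘ p) * 1ℤ
    cross = trans (cong ((↥ p * ℤ.+ t) *_) (cong ℤ.+_ (ℕ.*-identityˡ (↧ₙ p)))) (trans (id₁ (↥ p) (ℤ.+ t) (↧ p))
      (cong (λ x → x * ↥ p * 1ℤ) (trans (sym (ℤ.pos-* t (↧ₙ p))) (cong ℤ.+_ (sym b≡t*d)))))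
      where
      id₁ : ∀ n t d → n * t * d ≡ t * d * n * 1ℤ
      id₁ = solve-∀

  -- `sumUpTo` splits off its last term, whereas `⊛` recurses on the first; this reconciles `conv`
  -- with `⊛`.
  sumUpTo-head : ∀ k h → sumUpTo (suc k) h ≡ h 0 ℚ.+ sumUpTo k (h ∘ suc)
  sumUpTo-head zero    h = refl
  sumUpTo-head (suc k) h = trans (cong (ℚ._+ h (suc (suc k))) (sumUpTo-head k h))
    (ℚ.+-assoc (h 0) (sumUpTo k (h ∘ suc)) (h (suc (suc k))))

  toℚ-⊛ : ∀ b {A a} F → (∀ i → toℚ (A i) ≡ b ℚ.* a i) → ∀ k → toℚ ((A ⊛ F) k) ≡ b ℚ.* conv a (toℚ ∘ F) k
  toℚ-⊛ b {A} {a} F A≡ba zero = trans (toℚ-homo-* (A 0) (F 0))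
    (trans (cong (ℚ._* toℚ (F 0)) (A≡ba 0)) (ℚ.*-assoc b (a 0) (toℚ (F 0))))
  toℚ-⊛ b {A} {a} F A≡ba (suc k) = begin
    toℚ (A 0 * F (suc k) + (tail A ⊛ F) k)
      ≡⟨ toℚ-homo-+ (A 0 * F (suc k)) ((tail A ⊛ F) k) ⟩
    toℚ (A 0 * F (suc k)) ℚ.+ toℚ ((tail A ⊛ F) k)
      ≡⟨ cong₂ ℚ._+_ (trans (toℚ-homo-* (A 0) (F (suc k))) (cong (ℚ._* toℚ (F (suc k))) (A≡ba 0)))
                     (toℚ-⊛ b F (A≡ba ∘ suc) k) ⟩
    b ℚ.* a 0 ℚ.* toℚ (F (suc k)) ℚ.+ b ℚ.* conv (a ∘ suc) (toℚ ∘ F) k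
      ≡⟨ cong (ℚ._+ b ℚ.* conv (a ∘ suc) (toℚ ∘ F) k) (ℚ.*-assoc b (a 0) (toℚ (F (suc k)))) ⟩
    b ℚ.* (a 0 ℚ.* toℚ (F (suc k))) ℚ.+ b ℚ.* conv (a ∘ suc) (toℚ ∘ F) k
      ≡⟨ ℚ.*-distribˡ-+ b (a 0 ℚ.* toℚ (F (suc k))) (conv (a ∘ suc) (toℚ ∘ F) k) ⟨
    b ℚ.* (a 0 ℚ.* toℚ (F (suc k)) ℚ.+ conv (a ∘ suc) (toℚ ∘ F) k)
      ≡⟨ cong (b ℚ.*_) (sumUpTo-head k (λ i → a i ℚ.* toℚ (F (suc k ∸ i)))) ⟨
    b ℚ.* conv a (toℚ ∘ F) (suc k) ∎
    where open ≡-Reasoning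

  ∣-lcmFin : ∀ {n} (h : Fin n → ℕ) i → h i ℕ.∣ lcmFin h
  ∣-lcmFin h zero    = m∣lcm[m,n] (h zero) _
  ∣-lcmFin h (suc i) = ℕ.∣-trans (∣-lcmFin (h ∘ suc) i) (n∣lcm[m,n] (h zero) _)

  clear-denominators : ∀ {n} b (p : Fin n → ℚ) → (∀ i → ↧ₙ p i ℕ.∣ b) →
    ∃[ P ] Below n P × (∀ k → toℚ (P k) ≡ toℚ (ℤ.+ b) ℚ.* coeff 0ℚ p k)
  clear-denominators {n} b p d∣b = toSeq z , coeff-below 0ℤ z , scaled
    where
    z : Fin n → ℤ
    z i = proj₁ (clear-denominator b (p i) (d∣b i))
    scaled : ∀ k → toℚ (toSeq z k) ≡ toℚ (ℤ.+ b) ℚ.* coeff 0ℚ p k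
    scaled k with k <? n
    ... | yes k<n = proj₂ (clear-denominator b (p (fromℕ< k<n)) (d∣b (fromℕ< k<n)))
    ... | no  _   = sym (ℚ.*-zeroʳ (toℚ (ℤ.+ b)))

  integral-bezout : ∀ {m n} (f : Fin (suc m) → ℤ) (g : Fin (suc n) → ℤ) p q → IsBezout f g p q →
    ∃[ P ] ∃[ Q ] Below n P × Below m Q × P ⊛ toSeq f ⊕ Q ⊛ toSeq g ≈ ℤ.+ B p q · 𝟙
  integral-bezout f g p q bezout = P , Q , P< , Q< , λ k → toℚ-injective (begin
    toℚ ((P ⊛ F) k + (Q ⊛ G) k)
      ≡⟨ toℚ-homo-+ ((P ⊛ F) k) ((Q ⊛ G) k) ⟩
    toℚ ((P ⊛ F) k) ℚ.+ toℚ ((Q ⊛ G) k)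
      ≡⟨ cong₂ ℚ._+_ (toℚ-⊛ b F P≡ k) (toℚ-⊛ b G Q≡ k) ⟩
    b ℚ.* conv (coeff 0ℚ p) (toℚ ∘ F) k ℚ.+ b ℚ.* conv (coeff 0ℚ q) (toℚ ∘ G) k
      ≡⟨ ℚ.*-distribˡ-+ b (conv (coeff 0ℚ p) (toℚ ∘ F) k) (conv (coeff 0ℚ q) (toℚ ∘ G) k) ⟨
    b ℚ.* (conv (coeff 0ℚ p) (toℚ ∘ F) k ℚ.+ conv (coeff 0ℚ q) (toℚ ∘ G) k)
      ≡⟨ cong (b ℚ.*_) (trans (bezout k) (one≡toℚ-𝟙 k)) ⟩
    b ℚ.* toℚ (𝟙 k)
      ≡⟨ toℚ-homo-* (ℤ.+ B p q) (𝟙 k) ⟨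
    toℚ (ℤ.+ B p q * 𝟙 k) ∎)
    where
    open ≡-Reasoning
    b = toℚ (ℤ.+ B p q)
    F = toSeq f
    G = toSeq g
    clear-p = clear-denominators (B p q) p (λ i → ℕ.∣-trans (∣-lcmFin (λ i → ↧ₙ p i) i) (m∣lcm[m,n] _ _))
    clear-q = clear-denominators (B p q) q (λ i → ℕ.∣-trans (∣-lcmFin (λ i → ↧ₙ q i) i)
      (n∣lcm[m,n] (lcmFin (λ i → ↧ₙ p i)) _))
    P = proj₁ clear-p
    Q = proj₁ clear-q
    P< = proj₁ (proj₂ clear-p)
    Q< = proj₁ (proj₂ clear-q)
    P≡ = proj₂ (proj₂ clear-p)
    Q≡ = proj₂ (proj₂ clear-q)
    one≡toℚ-𝟙 : ∀ k → one k ≡ toℚ (𝟙 k)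
    one≡toℚ-𝟙 zero    = refl
    one≡toℚ-𝟙 (suc k) = refl

  -- Powers and greatest common divisors

  -- A common divisor of a and b c is coprime to b because it divides a; hence it divides c.
  coprime-*ʳ : ∀ {a b c} → Coprime a b → Coprime a c → Coprime a (b ℕ.* c)
  coprime-*ʳ ab ac (d∣a , d∣bc) = ac (d∣a , coprime-divisor (λ (e∣d , e∣b) → ab (ℕ.∣-trans e∣d d∣a , e∣b)) d∣bc)

  coprime-^ʳ : ∀ {a b} k → Coprime a b → Coprime a (b ^ k)
  coprime-^ʳ {a} zero    _  = Coprime.sym (Coprime.1-coprimeTo a)
  coprime-^ʳ     (suc k) ab = coprime-*ʳ ab (coprime-^ʳ k ab)

  coprime-^ : ∀ {a b} k → Coprime a b → Coprime (a ^ k) (b ^ k)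
  coprime-^ k ab = Coprime.sym (coprime-^ʳ k (Coprime.sym (coprime-^ʳ k ab)))

  ^-distribʳ-* : ∀ k a b → (a ℕ.* b) ^ k ≡ a ^ k ℕ.* b ^ k
  ^-distribʳ-* zero    a b = refl
  ^-distribʳ-* (suc k) a b = trans (cong (a ℕ.* b ℕ.*_) (^-distribʳ-* k a b)) (id₁ a b (a ^ k) (b ^ k))
    where
    id₁ : ∀ a b x y → a ℕ.* b ℕ.* (x ℕ.* y) ≡ a ℕ.* x ℕ.* (b ℕ.* y)
    id₁ = ℕ-Solver.solve-∀

  -- Write a = a′ e and b = b′ e with e the gcd. Then a′^k and b′^k are coprime, and `d` divides
  -- both of their products with e^k x. That `a` is nonzero allows e to be cancelled when a′ and b′
  -- are shown coprime.
  ∣-gcd-^ : ∀ {d} a b k x → a ≢ 0 → d ℕ.∣ a ^ k ℕ.* x → d ℕ.∣ b ^ k ℕ.* x → d ℕ.∣ gcd a b ^ k ℕ.* x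
  ∣-gcd-^ {d} a b k x a≢0 d∣a d∣b with gcd[m,n]∣m a b | gcd[m,n]∣n a b
  ... | ℕ.divides a′ a≡ | ℕ.divides b′ b≡ =
    coprime-factors (coprime-^ k coprime) (reduce a≡ d∣a , reduce b≡ d∣b)
    where
    e = gcd a b
    reduce : ∀ {c c′} → c ≡ c′ ℕ.* e → d ℕ.∣ c ^ k ℕ.* x → d ℕ.∣ c′ ^ k ℕ.* (e ^ k ℕ.* x)
    reduce {c′ = c′} c≡ = subst (d ℕ.∣_) (trans (cong (λ y → y ^ k ℕ.* x) c≡)
      (trans (cong (ℕ._* x) (^-distribʳ-* k c′ e)) (ℕ.*-assoc (c′ ^ k) (e ^ k) x)))
    instance
      e≢0 : ℕ.NonZero e
      e≢0 = ℕ.≢-nonZero (a≢0 ∘ gcd[m,n]≡0⇒m≡0)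
    coprime : Coprime a′ b′
    coprime {c} (c∣a′ , c∣b′) = ℕ.∣1⇒≡1 (ℕ.*-cancelʳ-∣ e (subst (c ℕ.* e ℕ.∣_) (sym (ℕ.*-identityˡ e))
      (gcd-greatest (subst (c ℕ.* e ℕ.∣_) (sym a≡) (ℕ.*-monoˡ-∣ e c∣a′))
                    (subst (c ℕ.* e ℕ.∣_) (sym b≡) (ℕ.*-monoˡ-∣ e c∣b′)))))

  ^-monoʳ-∣ : ∀ b {m n} → m ≤ n → b ^ m ℕ.∣ b ^ n
  ^-monoʳ-∣ b {m} {n} m≤n = ℕ.divides (b ^ (n ∸ m))
    (trans (cong (b ^_) (sym (ℕ.m∸n+n≡m m≤n))) (ℕ.^-distribˡ-+-* b (n ∸ m) m))

  -- Divisibility of the resultant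

  module _ {m n : ℕ} (f : Fin (suc m) → ℤ) (g : Fin (suc n) → ℤ) where

    sylvesterRows : Vec Seq (n ℕ.+ m)
    sylvesterRows = shifts n (toSeq f) ++ shifts m (toSeq g)

    span-shiftˡ : ∀ j → j < n → Span sylvesterRows (shift j (toSeq f))
    span-shiftˡ j j<n with shifts-occurs n (toSeq f) j<n
    ... | i , eq = subst (Span sylvesterRows)
      (trans (lookup-++ˡ (shifts n (toSeq f)) (shifts m (toSeq g)) i) eq) (gen (i ↑ˡ m))

    span-shiftʳ : ∀ j → j < m → Span sylvesterRows (shift j (toSeq g))
    span-shiftʳ j j<m with shifts-occurs m (toSeq g) j<m
    ... | i , eq = subst (Span sylvesterRows)
      (trans (lookup-++ʳ (shifts n (toSeq f)) (shifts m (toSeq g)) i) eq) (gen (n ↑ʳ i))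

  R-∣-leadingˡ : ∀ m n (f : Fin (suc m) → ℤ) (g : Fin (suc n) → ℤ) → 1 ≤ m →
    L f ≢ 0ℤ → ∀ p q → IsBezout f g p q →
    R f g ℕ.∣ ∣ L f ∣ ^ (m ℕ.+ n ∸ 1) ℕ.* B p q ^ m
  R-∣-leadingˡ (suc i) n f g _ Lf≢0 p q bezout =
    let P , Q , P< , Q< , PF+QG≈B = integral-bezout f g p q bezout in
    subst (λ r → ∣ r ∣ ℕ.∣ ∣ L f ∣ ^ (i ℕ.+ n) ℕ.* B p q ^ suc i) (sym (Res≡coeffDet f g))
      (coeffDet-∣ i n {ℤ.+ B p q} {toSeq f} {toSeq g} {P} {Q} Lf≢0 (coeff-below 0ℤ f) (coeff-below 0ℤ g) P< Q<
        PF+QG≈B {s = sylvesterRows f g} refl (span-shiftˡ f g) (span-shiftʳ f g))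

  -- The polynomials and their cofactors trade places while the Sylvester rows stay as they are, so
  -- no sign rule for exchanging f and g in the resultant is needed.
  R-∣-leadingʳ : ∀ m n (f : Fin (suc m) → ℤ) (g : Fin (suc n) → ℤ) → 1 ≤ n →
    L g ≢ 0ℤ → ∀ p q → IsBezout f g p q →
    R f g ℕ.∣ ∣ L g ∣ ^ (m ℕ.+ n ∸ 1) ℕ.* B p q ^ n
  R-∣-leadingʳ m (suc i) f g _ Lg≢0 p q bezout =
    let P , Q , P< , Q< , PF+QG≈B = integral-bezout f g p q bezout in
    subst₂ (λ r e → ∣ r ∣ ℕ.∣ ∣ L g ∣ ^ e ℕ.* B p q ^ suc i)
      (sym (Res≡coeffDet f g))
      (trans (ℕ.+-comm i m) (cong ℕ.pred (sym (ℕ.+-suc m i))))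
      (coeffDet-∣ i m {ℤ.+ B p q} {toSeq g} {toSeq f} {Q} {P} Lg≢0 (coeff-below 0ℤ g) (coeff-below 0ℤ f) Q< P<
        (λ k → trans (ℤ.+-comm ((Q ⊛ toSeq g) k) ((P ⊛ toSeq f) k)) (PF+QG≈B k))
        {s = sylvesterRows f g} (ℕ.+-comm (suc i) m) (span-shiftʳ f g) (span-shiftˡ f g))

-- Combining the bounds for f and g

open import Data.Nat using (ℕ; suc; _+_; _∸_; _^_; _*_; _⊔_; _⊓_; _≤_)
open import Data.Nat.Divisibility using (_∣_; ∣-trans; *-monoʳ-∣)
import Data.Nat.Properties as ℕ
open import Data.Fin using (Fin)
open import Data.Integer using (ℤ; 1ℤ; 0ℤ; ∣_∣)
import Data.Integer.Properties as ℤ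
open import Data.Rational using (ℚ)
open import Relation.Binary.PropositionalEquality using (_≡_; _≢_; refl; sym; trans; cong; subst)
open SylvesterLattice using (R-∣-leadingˡ; R-∣-leadingʳ; ∣-gcd-^; ^-monoʳ-∣)

theorem5p6 : (m n : ℕ) (f : Fin (suc m) → ℤ) (g : Fin (suc n) → ℤ)
  → 1 ≤ m → 1 ≤ n → L f ≢ 0ℤ → L g ≢ 0ℤ
  → (p : Fin n → ℚ) (q : Fin m → ℚ) → IsBezout f g p q
  → (R f g ∣ gcdL f g ^ (m + n ∸ 1) * B p q ^ (m ⊔ n))
    × (L f ≡ 1ℤ → L g ≡ 1ℤ → R f g ∣ B p q ^ (m ⊓ n))
theorem5p6 m n f g 1≤m 1≤n Lf≢0 Lg≢0 p q bezout =
  -- Raising both powers of `b` to the maximum gives the two bounds a common cofactor.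
  ∣-gcd-^ (∣ L f ∣) (∣ L g ∣) e (b ^ (m ⊔ n)) (Lf≢0 ∘ ℤ.∣i∣≡0⇒i≡0)
    (∣-trans R∣f (*-monoʳ-∣ (∣ L f ∣ ^ e) (^-monoʳ-∣ b (ℕ.m≤m⊔n m n))))
    (∣-trans R∣g (*-monoʳ-∣ (∣ L g ∣ ^ e) (^-monoʳ-∣ b (ℕ.m≤n⊔m m n)))) ,
  λ Lf≡1 Lg≡1 →
    -- The minimum is one of the two degrees, and the bound from the polynomial of that degree
    -- already has this exponent.
    [ (λ m⊓n≡m → subst (λ l → R f g ∣ b ^ l) (sym m⊓n≡m) (drop-unit Lf≡1 R∣f))
    , (λ m⊓n≡n → subst (λ l → R f g ∣ b ^ l) (sym m⊓n≡n) (drop-unit Lg≡1 R∣g))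
    ]′ (ℕ.⊓-sel m n)
  where
  e = m + n ∸ 1
  b = B p q
  R∣f : R f g ∣ ∣ L f ∣ ^ e * b ^ m
  R∣f = R-∣-leadingˡ m n f g 1≤m Lf≢0 p q bezout
  R∣g : R f g ∣ ∣ L g ∣ ^ e * b ^ n
  R∣g = R-∣-leadingʳ m n f g 1≤n Lg≢0 p q bezout
  drop-unit : ∀ {a r x} → a ≡ 1ℤ → r ∣ ∣ a ∣ ^ e * x → r ∣ x
  drop-unit {r = r} {x} refl = subst (r ∣_) (trans (cong (_* x) (ℕ.^-zeroˡ e)) (ℕ.*-identityˡ x))
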